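{- If $\mathbf V$ satisfies the core axioms of material set theory along with infinity, exponentials, foundation, and transitive closures, then there is a canonical embedding $\mathbf V\to\mathbb V(\mathbb{S}\mathrm{et}(\mathbf V))$. This map is an isomorphism if and only if $\mathbf V$ additionally satisfies Mostowski's principle.
   Context: **Material set theory.** One-sorted intuitionistic first-order logic with a binary relation $\in$; $\mathbf V$ is a model; schemas allow parameters. $\Delta_0$-formulas have only bounded quantifiers $\exists x\in a$, $\forall x\in a$. Core axioms: *Extensionality*; *Empty set*; *Pairing*; *Union*; *$\Delta_0$-Separation* (for $\Delta_0$ $\varphi(x)$ and any $a$, $\{x\in a\mid\varphi(x)\}$ exists); *Limited $\Delta_0$-replacement* (for $\Delta_0$ $\varphi(x,y)$: for all $a,b$, if for every $x\in a$ there is a unique $y$ with $\varphi(x,y)$, and moreover $z\subseteq b$ for all $z\in y$, then $\{y\mid\exists x\in a,\ \varphi(x,y)\}$ exists). *Exponentials*: for any $a,b$ the set of all functions from $a$ to $b$ exists. *Infinity*: there is a set $\omega$ with $\emptyset\in\omega$, closed under $x\mapsto x\cup\{x\}$, and contained in every set with these properties. *Foundation*: for any $\Delta_0$-formula $\varphi(x)$, if for every $y$, ($\varphi(x)$ for all $x\in y$) implies $\varphi(y)$, then $\varphi(x)$ for all $x$. *Transitive closures*: every set is a subset of a smallest transitive set. *Mostowski's principle*: every well-founded extensional relation is isomorphic to a transitive set equipped with $\in$. Here a relation $\prec$ on a set $X$ is well-founded if the only subset $Y\subseteq X$ such that (all $y\prec x$ lie in $Y$) implies $x\in Y$ is $Y=X$,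 and extensional if elements with the same $\prec$-predecessors are equal. **$\mathbb{S}\mathrm{et}(\mathbf V)$** is the category of sets and functions in $\mathbf V$; under the hypotheses it is a constructively well-pointed $\Pi$-pretopos (locally cartesian closed Heyting pretopos in which $1$ is a projective, indecomposable, nonempty strong generator) with a natural numbers object. **$\mathbb V(\mathbf{Set})$** for such a category $\mathbf{Set}$: a graph is an object $X$ with a binary relation $\prec$; its nodes are the global elements $1\to X$. It is pointed if equipped with a node $\star$ (the root), and accessible if every node $x$ has a finite path $x=x_n\prec\dots\prec x_0=\star$. It is well-founded if every subobject $S$ of $X$ such that any node all of whose $\prec$-predecessors lie in $S$ is in $S$ equals $X$; it is extensional if nodes with the same $\prec$-predecessors are equal. $X/x$ is the full subgraph of nodes admitting a path to $x$, pointed by $x$. $\mathbb V(\mathbf{Set})$ is the class of well-founded extensional accessible pointed graphs, with equality interpreted as isomorphism of pointed graphs and membership $X\mathrel{\epsilon}Y$ meaning $X\cong Y/y$ for some $y\prec\star$ in $Y$. Embeddings and isomorphisms are those of structures for the language with $\in$ and equality. -}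

module Defs where

open import Level using (Level) renaming (suc to lsuc)
open import Data.Empty using (⊥-elim)
open import Data.Empty.Polymorphic using (⊥)
open import Data.Fin.Base using (Fin; zero; suc)
open import Data.Nat.Base using (ℕ; suc)
open import Data.Product.Base using (Σ; ∃; ∃-syntax; _×_; _,_; proj₁; proj₂)
open import Data.Product using (∃!)
open import Data.Sum.Base using (_⊎_; inj₁; inj₂)
open import Data.Vec.Base using (Vec; []; _∷_; lookup)
open import Data.Vec.Relation.Binary.Pointwise.Inductive as Pw using (Pointwise; []; _∷_)
open import Function.Base using (id)
open import Function.Bundles using (_⇔_; mk⇔; module Equivalence)
open import Relation.Binary.Core using (Rel)
open import Relation.Binary.Definitions using (_Respects₂_)
open import Relation.Binary.Structures using (IsEquivalence)
open import Relation.Nullary.Negation.Core using (¬_)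

open Equivalence using (to; from)

-- A structure for the first-order language with ∈ and equality. Equality is an
-- equivalence relation respected by ∈, since in 𝕍 below it is isomorphism.
record ∈-Structure (ℓ : Level) : Set (lsuc ℓ) where
  infix 4 _≈_ _∈_
  field
    Carrier       : Set ℓ
    _≈_           : Rel Carrier ℓ
    _∈_           : Rel Carrier ℓ
    isEquivalence : IsEquivalence _≈_
    ∈-resp-≈      : _∈_ Respects₂ _≈_

infix  7 _∈̇_ _≈̇_
infixr 6 _∧̇_
infixr 5 _∨̇_
infixr 4 _⇒̇_

-- Δ₀-formulas with n free variables (de Bruijn indices). ¬ φ is φ ⇒̇ ⊥̇.

data Δ₀ (n : ℕ) : Set where
  _∈̇_ _≈̇_       : Fin n → Fin n → Δ₀ n
  ⊥̇             : Δ₀ n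
  _∧̇_ _∨̇_ _⇒̇_ : Δ₀ n → Δ₀ n → Δ₀ n
  ∀̇∈ ∃̇∈        : Fin n → Δ₀ (suc n) → Δ₀ n

module Axioms {ℓ} (V : ∈-Structure ℓ) where
  open ∈-Structure V renaming (Carrier to 𝐕)

  -- Intuitionistic first-order logic is read through propositions as types, both
  -- for Δ₀-formulas and in the axioms.
  infix 3 _⊨_

  _⊨_ : ∀ {n} → Vec 𝐕 n → Δ₀ n → Set ℓ
  ρ ⊨ i ∈̇ j   = lookup ρ i ∈ lookup ρ j
  ρ ⊨ i ≈̇ j   = lookup ρ i ≈ lookup ρ j
  ρ ⊨ ⊥̇       = ⊥
  ρ ⊨ φ ∧̇ ψ   = (ρ ⊨ φ) × (ρ ⊨ ψ)
  ρ ⊨ φ ∨̇ ψ   = (ρ ⊨ φ) ⊎ (ρ ⊨ ψ)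
  ρ ⊨ φ ⇒̇ ψ   = (ρ ⊨ φ) → (ρ ⊨ ψ)
  ρ ⊨ ∀̇∈ i φ  = ∀ x → x ∈ lookup ρ i → x ∷ ρ ⊨ φ
  ρ ⊨ ∃̇∈ i φ  = ∃[ x ] x ∈ lookup ρ i × (x ∷ ρ ⊨ φ)

  infix 4 _⊆_

  _⊆_ : Rel 𝐕 ℓ
  a ⊆ b = ∀ x → x ∈ a → x ∈ b

  IsEmpty : 𝐕 → Set ℓ
  IsEmpty e = ∀ x → ¬ x ∈ e

  Transitive : 𝐕 → Set ℓ
  Transitive a = ∀ x → x ∈ a → x ⊆ a

  -- y = x ∪ {x}
  IsSuccessor : 𝐕 → 𝐕 → Set ℓ
  IsSuccessor x y = x ⊆ y × x ∈ y × (∀ z → z ∈ y → z ∈ x ⊎ z ≈ x)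

  -- p = {x , y}
  IsUnorderedPair : 𝐕 → 𝐕 → 𝐕 → Set ℓ
  IsUnorderedPair p x y = x ∈ p × y ∈ p × (∀ z → z ∈ p → z ≈ x ⊎ z ≈ y)

  -- p = {{x} , {x , y}}
  IsPair : 𝐕 → 𝐕 → 𝐕 → Set ℓ
  IsPair p x y =
    (∃[ s ] s ∈ p × IsUnorderedPair s x x) ×
    (∃[ s ] s ∈ p × IsUnorderedPair s x y) ×
    (∀ s → s ∈ p → IsUnorderedPair s x x ⊎ IsUnorderedPair s x y)

  -- (x , y) ∈ r
  Holds : 𝐕 → 𝐕 → 𝐕 → Set ℓ
  Holds r x y = ∃[ p ] p ∈ r × IsPair p x y

  -- r ⊆ a × b
  IsRelation : 𝐕 → 𝐕 → 𝐕 → Set ℓ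
  IsRelation r a b = ∀ p → p ∈ r → ∃[ x ] x ∈ a × (∃[ y ] y ∈ b × IsPair p x y)

  IsFunction : 𝐕 → 𝐕 → 𝐕 → Set ℓ
  IsFunction f a b = IsRelation f a b × (∀ x → x ∈ a → ∃! _≈_ (Holds f x))

  IsBijection : 𝐕 → 𝐕 → 𝐕 → Set ℓ
  IsBijection f a b =
    IsFunction f a b ×
    (∀ x x′ y → Holds f x y → Holds f x′ y → x ≈ x′) ×
    (∀ y → y ∈ b → ∃[ x ] Holds f x y)

  Extensionality : Set ℓ
  Extensionality = ∀ a b → (∀ x → x ∈ a ⇔ x ∈ b) → a ≈ b

  EmptySet : Set ℓ
  EmptySet = ∃[ e ] IsEmpty e

  Pairing : Set ℓ
  Pairing = ∀ a b → ∃[ p ] (∀ x → x ∈ p ⇔ (x ≈ a ⊎ x ≈ b))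

  Union : Set ℓ
  Union = ∀ a → ∃[ u ] (∀ x → x ∈ u ⇔ (∃[ y ] y ∈ a × x ∈ y))

  Δ₀-Separation : Set ℓ
  Δ₀-Separation = ∀ {n} (φ : Δ₀ (suc n)) (ρ : Vec 𝐕 n) a →
    ∃[ b ] (∀ x → x ∈ b ⇔ (x ∈ a × (x ∷ ρ ⊨ φ)))

  LimitedΔ₀-Replacement : Set ℓ
  LimitedΔ₀-Replacement = ∀ {n} (φ : Δ₀ (suc (suc n))) (ρ : Vec 𝐕 n) a b →
    (∀ x → x ∈ a → ∃! _≈_ (λ y → x ∷ y ∷ ρ ⊨ φ)) →
    (∀ x → x ∈ a → ∀ y → (x ∷ y ∷ ρ ⊨ φ) → ∀ z → z ∈ y → z ⊆ b) →
    ∃[ c ] (∀ y → y ∈ c ⇔ (∃[ x ] x ∈ a × (x ∷ y ∷ ρ ⊨ φ)))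

  record CoreAxioms : Set ℓ where
    field
      extensionality : Extensionality
      emptySet       : EmptySet
      pairing        : Pairing
      union          : Union
      separation     : Δ₀-Separation
      replacement    : LimitedΔ₀-Replacement

  Exponentials : Set ℓ
  Exponentials = ∀ a b → ∃[ e ] (∀ f → f ∈ e ⇔ IsFunction f a b)

  IsInductive : 𝐕 → Set ℓ
  IsInductive w =
    (∀ x → IsEmpty x → x ∈ w) ×
    (∀ x → x ∈ w → ∀ y → IsSuccessor x y → y ∈ w)

  Infinity : Set ℓ
  Infinity = ∃[ ω ] IsInductive ω × (∀ w → IsInductive w → ω ⊆ w)

  Foundation : Set ℓ
  Foundation = ∀ {n} (φ : Δ₀ (suc n)) (ρ : Vec 𝐕 n) →
    (∀ y → (∀ x → x ∈ y → x ∷ ρ ⊨ φ) → y ∷ ρ ⊨ φ) →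
    ∀ x → x ∷ ρ ⊨ φ

  TransitiveClosures : Set ℓ
  TransitiveClosures = ∀ a →
    ∃[ t ] a ⊆ t × Transitive t × (∀ s → a ⊆ s → Transitive s → t ⊆ s)

  IsWellFoundedRelation : 𝐕 → 𝐕 → Set ℓ
  IsWellFoundedRelation a r = ∀ s → s ⊆ a →
    (∀ x → x ∈ a → (∀ y → Holds r y x → y ∈ s) → x ∈ s) → s ≈ a

  IsExtensionalRelation : 𝐕 → 𝐕 → Set ℓ
  IsExtensionalRelation a r = ∀ x y → x ∈ a → y ∈ a →
    (∀ z → Holds r z x ⇔ Holds r z y) → x ≈ y

  Mostowski : Set ℓ
  Mostowski = ∀ a r → IsRelation r a a →
    IsWellFoundedRelation a r → IsExtensionalRelation a r →
    ∃[ t ] Transitive t × (∃[ f ] IsBijection f a t ×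
      (∀ x y u v → Holds f x u → Holds f y v → Holds r x y ⇔ u ∈ v))

record Category (ℓ : Level) : Set (lsuc ℓ) where
  infix  4 _≈_ _⇒_
  infixr 9 _∘_
  field
    Obj       : Set ℓ
    _⇒_       : Obj → Obj → Set ℓ
    _≈_       : ∀ {A B} → Rel (A ⇒ B) ℓ
    idm       : ∀ {A} → A ⇒ A
    _∘_       : ∀ {A B C} → B ⇒ C → A ⇒ B → A ⇒ C
    equiv     : ∀ {A B} → IsEquivalence (_≈_ {A} {B})
    assoc     : ∀ {A B C D} (h : C ⇒ D) (g : B ⇒ C) (f : A ⇒ B) →
                (h ∘ g) ∘ f ≈ h ∘ (g ∘ f)
    identityˡ : ∀ {A B} (f : A ⇒ B) → idm ∘ f ≈ f
    identityʳ : ∀ {A B} (f : A ⇒ B) → f ∘ idm ≈ f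
    ∘-resp-≈  : ∀ {A B C} {g g′ : B ⇒ C} {f f′ : A ⇒ B} →
                g ≈ g′ → f ≈ f′ → g ∘ f ≈ g′ ∘ f′

  Mono : ∀ {A B} → A ⇒ B → Set ℓ
  Mono {A} m = ∀ {Z} (u v : Z ⇒ A) → m ∘ u ≈ m ∘ v → u ≈ v

  Iso : ∀ {A B} → A ⇒ B → Set ℓ
  Iso {A} {B} f = ∃[ g ] (g ∘ f ≈ idm {A} × f ∘ g ≈ idm {B})

record Terminal {ℓ} (𝒞 : Category ℓ) : Set ℓ where
  open Category 𝒞
  field
    𝟙        : Obj
    !        : ∀ A → A ⇒ 𝟙
    !-unique : ∀ {A} (f : A ⇒ 𝟙) → f ≈ ! A

record NNO {ℓ} (𝒞 : Category ℓ) (𝒯 : Terminal 𝒞) : Set ℓ where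
  open Category 𝒞
  open Terminal 𝒯
  field
    N          : Obj
    z          : 𝟙 ⇒ N
    s          : N ⇒ N
    iter       : ∀ {X} → 𝟙 ⇒ X → X ⇒ X → N ⇒ X
    iter-z     : ∀ {X} (a : 𝟙 ⇒ X) (t : X ⇒ X) → iter a t ∘ z ≈ a
    iter-s     : ∀ {X} (a : 𝟙 ⇒ X) (t : X ⇒ X) → iter a t ∘ s ≈ t ∘ iter a t
    iter-uniq  : ∀ {X} (a : 𝟙 ⇒ X) (t : X ⇒ X) (h : N ⇒ X) →
                 h ∘ z ≈ a → h ∘ s ≈ t ∘ h → h ≈ iter a t

module Graphs {ℓ} (𝒞 : Category ℓ) (𝒯 : Terminal 𝒞) (𝒩 : NNO 𝒞 𝒯) where
  open Category 𝒞
  open Terminal 𝒯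
  open NNO 𝒩

  private
    module E {A B} = IsEquivalence (equiv {A} {B})

  infix 4 _∈ₘ_ _<_

  -- Membership of a global element in the subobject m.
  _∈ₘ_ : ∀ {S X} → 𝟙 ⇒ X → S ⇒ X → Set ℓ
  x ∈ₘ m = ∃[ u ] m ∘ u ≈ x

  -- m < n for global elements of N: n = k + (m + 1) for some k, where
  -- k + (-) is the iterate of s starting at k.
  _<_ : Rel (𝟙 ⇒ N) ℓ
  m < n = ∃[ k ] iter k s ∘ (s ∘ m) ≈ n

  -- The relation is a subobject of X × X, given as a jointly monic pair.
  record Graph : Set ℓ where
    field
      X             : Obj
      R             : Obj
      source target : R ⇒ X
      jointly-monic : ∀ {Z} (u v : Z ⇒ R) →
                      source ∘ u ≈ source ∘ v → target ∘ u ≈ target ∘ v → u ≈ v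

    infix 4 _≺_

    Node : Set ℓ
    Node = 𝟙 ⇒ X

    _≺_ : Rel Node ℓ
    x ≺ y = ∃[ r ] (source ∘ r ≈ x × target ∘ r ≈ y)

    -- A path x = xₙ ≺ ⋯ ≺ x₀ = y. Its length n is an element of N, hence
    -- possibly nonstandard; the sequence is the restriction of p : N ⇒ X to
    -- {0, …, n}, and the values of p beyond n are irrelevant.
    Path : Rel Node ℓ
    Path x y = ∃[ n ] Σ (N ⇒ X) λ p →
      p ∘ n ≈ x × p ∘ z ≈ y ×
      (∀ m → m < n → p ∘ (s ∘ m) ≺ p ∘ m)

    -- The subobject m equals X when m is an isomorphism.
    IsWellFounded : Set ℓ
    IsWellFounded = ∀ {S} (m : S ⇒ X) → Mono m →
      (∀ x → (∀ y → y ≺ x → y ∈ₘ m) → x ∈ₘ m) → Iso m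

    IsExtensional : Set ℓ
    IsExtensional = ∀ x y → (∀ w → w ≺ x ⇔ w ≺ y) → x ≈ y

  record PointedGraph : Set ℓ where
    field
      graph : Graph
    open Graph graph public
    field
      ⋆ : Node

    IsAccessible : Set ℓ
    IsAccessible = ∀ x → Path x ⋆

  -- Relations are compared on nodes: in a category of sets, 1 is a strong generator.
  record _≅_ (G H : PointedGraph) : Set ℓ where
    private
      module G = PointedGraph G
      module H = PointedGraph H
    field
      fwd        : G.X ⇒ H.X
      bwd        : H.X ⇒ G.X
      bwd∘fwd    : bwd ∘ fwd ≈ idm
      fwd∘bwd    : fwd ∘ bwd ≈ idm
      fwd-≺      : ∀ x y → x G.≺ y ⇔ fwd ∘ x H.≺ fwd ∘ y
      fwd-⋆      : fwd ∘ G.⋆ ≈ H.⋆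

  -- H is G/x, by way of the inclusion incl.
  record IsSlice (G : Graph) (x : Graph.Node G) (H : PointedGraph) : Set ℓ where
    private
      module G = Graph G
      module H = PointedGraph H
    field
      incl      : H.X ⇒ G.X
      incl-mono : Mono incl
      nodes     : ∀ y → y ∈ₘ incl ⇔ G.Path y x
      full      : ∀ u v → u H.≺ v ⇔ incl ∘ u G.≺ incl ∘ v
      point     : incl ∘ H.⋆ ≈ x

  record WFExtAPG : Set ℓ where
    field
      pointedGraph : PointedGraph
    open PointedGraph pointedGraph public
    field
      accessible  : IsAccessible
      wellFounded : IsWellFounded
      extensional : IsExtensional

  infix 4 _≅ₐ_ _ε_

  _≅ₐ_ : Rel WFExtAPG ℓ
  G ≅ₐ H = WFExtAPG.pointedGraph G ≅ WFExtAPG.pointedGraph H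

  -- G ≅ H/y for some y ≺ ⋆. Slices are not chosen: S ranges over all realisations
  -- of H/y.
  _ε_ : Rel WFExtAPG ℓ
  G ε H = ∃[ y ] y H.≺ H.⋆ ×
          (∃[ S ] IsSlice H.graph y S × WFExtAPG.pointedGraph G ≅ S)
    where module H = WFExtAPG H

  ∘-resp : ∀ {A B C} (g : B ⇒ C) {f f′ : A ⇒ B} → f ≈ f′ → g ∘ f ≈ g ∘ f′
  ∘-resp g e = ∘-resp-≈ E.refl e

  cancel : ∀ {A B C} {g : B ⇒ C} {f : C ⇒ B} → f ∘ g ≈ idm →
           (h : A ⇒ B) → f ∘ (g ∘ h) ≈ h
  cancel e h = E.trans (E.sym (assoc _ _ h))
                 (E.trans (∘-resp-≈ e E.refl) (identityˡ h))

  ≺-resp : (G : Graph) → ∀ {x x′ y y′} → x ≈ x′ → y ≈ y′ →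
           Graph._≺_ G x y → Graph._≺_ G x′ y′
  ≺-resp G e e′ (r , p , q) = r , E.trans p e , E.trans q e′

  Path-map : (G H : Graph) (f : Graph.X G ⇒ Graph.X H) →
             (∀ x y → Graph._≺_ G x y → Graph._≺_ H (f ∘ x) (f ∘ y)) →
             ∀ {x y} → Graph.Path G x y → Graph.Path H (f ∘ x) (f ∘ y)
  Path-map G H f f-≺ (n , p , pn , p0 , step) =
    n , f ∘ p ,
    E.trans (assoc _ _ _) (∘-resp f pn) ,
    E.trans (assoc _ _ _) (∘-resp f p0) ,
    λ m m<n → ≺-resp H (E.sym (assoc _ _ _)) (E.sym (assoc _ _ _))
                (f-≺ _ _ (step m m<n))

  Path-resp : (G : Graph) → ∀ {x x′ y y′} → x ≈ x′ → y ≈ y′ →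
              Graph.Path G x y → Graph.Path G x′ y′
  Path-resp G e e′ (n , p , pn , p0 , step) =
    n , p , E.trans pn e , E.trans p0 e′ , step

  ≅-refl : ∀ {G} → G ≅ G
  ≅-refl {G} = record
    { fwd = idm ; bwd = idm
    ; bwd∘fwd = identityˡ _ ; fwd∘bwd = identityˡ _
    ; fwd-≺ = λ x y → mk⇔
        (≺-resp (PointedGraph.graph G) (E.sym (identityˡ _)) (E.sym (identityˡ _)))
        (≺-resp (PointedGraph.graph G) (identityˡ _) (identityˡ _))
    ; fwd-⋆ = identityˡ _ }

  ≅-sym : ∀ {G H} → G ≅ H → H ≅ G
  ≅-sym {G} {H} i = record
    { fwd = bwd ; bwd = fwd
    ; bwd∘fwd = fwd∘bwd ; fwd∘bwd = bwd∘fwd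
    ; fwd-≺ = λ x y → mk⇔
        (λ x≺y → from (fwd-≺ _ _)
           (≺-resp (PointedGraph.graph H)
             (E.sym (cancel fwd∘bwd x)) (E.sym (cancel fwd∘bwd y)) x≺y))
        (λ p → ≺-resp (PointedGraph.graph H) (cancel fwd∘bwd x) (cancel fwd∘bwd y)
           (to (fwd-≺ _ _) p))
    ; fwd-⋆ = E.trans (∘-resp bwd (E.sym fwd-⋆)) (cancel bwd∘fwd _) }
    where open _≅_ i

  ≅-trans : ∀ {G H K} → G ≅ H → H ≅ K → G ≅ K
  ≅-trans {G} {H} {K} i j = record
    { fwd = j.fwd ∘ i.fwd ; bwd = i.bwd ∘ j.bwd
    ; bwd∘fwd = E.trans (assoc _ _ _)
        (E.trans (∘-resp i.bwd (cancel j.bwd∘fwd i.fwd)) i.bwd∘fwd)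
    ; fwd∘bwd = E.trans (assoc _ _ _)
        (E.trans (∘-resp j.fwd (cancel i.fwd∘bwd j.bwd)) j.fwd∘bwd)
    ; fwd-≺ = λ x y → mk⇔
        (λ p → ≺-resp (PointedGraph.graph K) (E.sym (assoc _ _ _)) (E.sym (assoc _ _ _))
           (to (j.fwd-≺ _ _) (to (i.fwd-≺ _ _) p)))
        (λ p → from (i.fwd-≺ _ _) (from (j.fwd-≺ _ _)
           (≺-resp (PointedGraph.graph K) (assoc _ _ _) (assoc _ _ _) p)))
    ; fwd-⋆ = E.trans (assoc _ _ _) (E.trans (∘-resp j.fwd i.fwd-⋆) j.fwd-⋆) }
    where
    module i = _≅_ i
    module j = _≅_ j

  slice-≅ : ∀ {G H S y} (i : G ≅ H) → IsSlice (PointedGraph.graph G) y S →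
            IsSlice (PointedGraph.graph H) (_≅_.fwd i ∘ y) S
  slice-≅ {G} {H} {S} {y} i sl = record
    { incl = fwd ∘ incl
    ; incl-mono = λ u v e → incl-mono u v
        (E.trans (E.sym (cancel bwd∘fwd _))
          (E.trans (∘-resp bwd (E.trans (E.sym (assoc _ _ _)) (E.trans e (assoc _ _ _))))
            (cancel bwd∘fwd _)))
    ; nodes = λ w → mk⇔
        (λ where (u , e) → Path-resp H.graph (E.trans (E.sym (assoc _ _ _)) e) E.refl
                   (Path-map G.graph H.graph fwd (λ _ _ → to (fwd-≺ _ _))
                     (to (nodes _) (u , E.refl))))
        (λ p → let u , e = from (nodes _)
                             (Path-resp G.graph E.refl (cancel bwd∘fwd y)
                               (Path-map H.graph G.graph bwd
                                 (λ _ _ → to (_≅_.fwd-≺ (≅-sym i) _ _)) p))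
               in u , E.trans (assoc _ _ _)
                        (E.trans (∘-resp fwd e) (cancel fwd∘bwd w)))
    ; full = λ u v → mk⇔
        (λ p → ≺-resp H.graph (E.sym (assoc _ _ _)) (E.sym (assoc _ _ _))
           (to (fwd-≺ _ _) (to (full u v) p)))
        (λ p → from (full u v) (from (fwd-≺ _ _)
           (≺-resp H.graph (assoc _ _ _) (assoc _ _ _) p)))
    ; point = E.trans (assoc _ _ _) (∘-resp fwd point) }
    where
    open _≅_ i
    open IsSlice sl
    module G = PointedGraph G
    module H = PointedGraph H

  ε-respʳ : ∀ {G H H′} → H ≅ₐ H′ → G ε H → G ε H′
  ε-respʳ {H′ = H′} i (y , y≺⋆ , S , sl , j) =
    fwd ∘ y , ≺-resp (WFExtAPG.graph H′) E.refl fwd-⋆ (to (fwd-≺ _ _) y≺⋆) ,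
    S , slice-≅ i sl , j
    where open _≅_ i

  ε-respˡ : ∀ {G G′ H} → G ≅ₐ G′ → G ε H → G′ ε H
  ε-respˡ i (y , y≺⋆ , S , sl , j) = y , y≺⋆ , S , sl , ≅-trans (≅-sym i) j

  𝕍 : ∈-Structure ℓ
  𝕍 = record
    { Carrier       = WFExtAPG
    ; _≈_           = _≅ₐ_
    ; _∈_           = _ε_
    ; isEquivalence = record { refl = ≅-refl ; sym = ≅-sym ; trans = ≅-trans }
    ; ∈-resp-≈      = (λ {G} {H} {H′} → ε-respʳ {G} {H} {H′}) ,
                      (λ {H} {G} {G′} → ε-respˡ {G} {G′} {H})
    }

module Sets {ℓ} (V : ∈-Structure ℓ) (core : Axioms.CoreAxioms V) where
  open ∈-Structure V renaming (Carrier to 𝐕)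
  open Axioms V
  open CoreAxioms core

  private
    module E = IsEquivalence isEquivalence

  ∈-respˡ : ∀ {x y a} → x ≈ y → x ∈ a → y ∈ a
  ∈-respˡ = proj₂ ∈-resp-≈

  ∈-respʳ : ∀ {x a b} → a ≈ b → x ∈ a → x ∈ b
  ∈-respʳ = proj₁ ∈-resp-≈

  ⊨-resp-≈ : ∀ {n} (φ : Δ₀ n) {ρ σ : Vec 𝐕 n} → Pointwise _≈_ ρ σ → ρ ⊨ φ → σ ⊨ φ
  ⊨-resp-≈ (i ∈̇ j) es p = ∈-respˡ (Pw.lookup es i) (∈-respʳ (Pw.lookup es j) p)
  ⊨-resp-≈ (i ≈̇ j) es p = E.trans (E.sym (Pw.lookup es i)) (E.trans p (Pw.lookup es j))
  ⊨-resp-≈ (φ ∧̇ ψ) es (p , q) = ⊨-resp-≈ φ es p , ⊨-resp-≈ ψ es q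
  ⊨-resp-≈ (φ ∨̇ ψ) es (inj₁ p) = inj₁ (⊨-resp-≈ φ es p)
  ⊨-resp-≈ (φ ∨̇ ψ) es (inj₂ p) = inj₂ (⊨-resp-≈ ψ es p)
  ⊨-resp-≈ (φ ⇒̇ ψ) es f p = ⊨-resp-≈ ψ es (f (⊨-resp-≈ φ (Pw.sym E.sym es) p))
  ⊨-resp-≈ (∀̇∈ i φ) es f x x∈ =
    ⊨-resp-≈ φ (E.refl ∷ es) (f x (∈-respʳ (E.sym (Pw.lookup es i)) x∈))
  ⊨-resp-≈ (∃̇∈ i φ) es (x , x∈ , p) =
    x , ∈-respʳ (Pw.lookup es i) x∈ , ⊨-resp-≈ φ (E.refl ∷ es) p

  pattern v0 = zero
  pattern v1 = suc v0
  pattern v2 = suc v1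
  pattern v3 = suc v2
  pattern v4 = suc v3
  pattern v5 = suc v4
  pattern v6 = suc v5
  pattern v7 = suc v6
  pattern v8 = suc v7
  pattern v9 = suc v8

  -- The satisfaction of each of these unfolds to the predicate it is named after.

  ⌜⊆⌝ ⌜IsSuccessor⌝ : ∀ {n} → Fin n → Fin n → Δ₀ n
  ⌜⊆⌝ x y = ∀̇∈ x (v0 ∈̇ suc y)
  ⌜IsSuccessor⌝ x y = ⌜⊆⌝ x y ∧̇ x ∈̇ y ∧̇ ∀̇∈ y (v0 ∈̇ suc x ∨̇ v0 ≈̇ suc x)

  ⌜IsUnorderedPair⌝ ⌜IsPair⌝ ⌜Holds⌝ : ∀ {n} → Fin n → Fin n → Fin n → Δ₀ n
  ⌜IsUnorderedPair⌝ p x y = x ∈̇ p ∧̇ y ∈̇ p ∧̇ ∀̇∈ p (v0 ≈̇ suc x ∨̇ v0 ≈̇ suc y)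
  ⌜IsPair⌝ p x y =
    ∃̇∈ p (⌜IsUnorderedPair⌝ v0 (suc x) (suc x)) ∧̇
    ∃̇∈ p (⌜IsUnorderedPair⌝ v0 (suc x) (suc y)) ∧̇
    ∀̇∈ p (⌜IsUnorderedPair⌝ v0 (suc x) (suc x) ∨̇ ⌜IsUnorderedPair⌝ v0 (suc x) (suc y))
  ⌜Holds⌝ r x y = ∃̇∈ r (⌜IsPair⌝ v0 (suc x) (suc y))

  IsPair-resp : ∀ {p p′ x x′ y y′} → p ≈ p′ → x ≈ x′ → y ≈ y′ →
                IsPair p x y → IsPair p′ x′ y′
  IsPair-resp e₁ e₂ e₃ =
    ⊨-resp-≈ (⌜IsPair⌝ v0 v1 v2) {_ ∷ _ ∷ _ ∷ []} {_ ∷ _ ∷ _ ∷ []} (e₁ ∷ e₂ ∷ e₃ ∷ [])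

  Holds-resp : ∀ {r r′ x x′ y y′} → r ≈ r′ → x ≈ x′ → y ≈ y′ →
               Holds r x y → Holds r′ x′ y′
  Holds-resp e₁ e₂ e₃ =
    ⊨-resp-≈ (⌜Holds⌝ v0 v1 v2) {_ ∷ _ ∷ _ ∷ []} {_ ∷ _ ∷ _ ∷ []} (e₁ ∷ e₂ ∷ e₃ ∷ [])

  unorderedPair : ∀ x y → ∃[ p ] IsUnorderedPair p x y
  unorderedPair x y =
    let p , h = pairing x y in
    p , from (h x) (inj₁ E.refl) , from (h y) (inj₂ E.refl) , λ z → to (h z)

  IsUnorderedPair-unique : ∀ {p q x y} →
    IsUnorderedPair p x y → IsUnorderedPair q x y → p ≈ q
  IsUnorderedPair-unique {p} {q} {x} {y} P Q =
    extensionality _ _ λ z → mk⇔ (sub P Q z) (sub Q P z)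
    where
    sub : ∀ {p q} → IsUnorderedPair p x y → IsUnorderedPair q x y → p ⊆ q
    sub (_ , _ , h) (x∈ , y∈ , _) z z∈ with h z z∈
    ... | inj₁ e = ∈-respˡ (E.sym e) x∈
    ... | inj₂ e = ∈-respˡ (E.sym e) y∈

  pair : ∀ x y → ∃[ p ] IsPair p x y
  pair x y =
    let s , S = unorderedPair x x
        d , D = unorderedPair x y
        p , (s∈ , d∈ , h) = unorderedPair s d
    in p , (s , s∈ , S) , (d , d∈ , D) , λ z z∈ → case S D (h z z∈)
    where
    resp : ∀ {s z y} → s ≈ z → IsUnorderedPair s x y → IsUnorderedPair z x y
    resp {s} {z} {y} e =
      ⊨-resp-≈ (⌜IsUnorderedPair⌝ v0 v1 v2) {s ∷ x ∷ y ∷ []} {z ∷ x ∷ y ∷ []}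
        (e ∷ E.refl ∷ E.refl ∷ [])
    case : ∀ {s d z} → IsUnorderedPair s x x → IsUnorderedPair d x y →
           z ≈ s ⊎ z ≈ d → IsUnorderedPair z x x ⊎ IsUnorderedPair z x y
    case S D (inj₁ e) = inj₁ (resp (E.sym e) S)
    case S D (inj₂ e) = inj₂ (resp (E.sym e) D)

  IsPair-unique : ∀ {p q x y} → IsPair p x y → IsPair q x y → p ≈ q
  IsPair-unique {x = x} {y} P Q = extensionality _ _ λ z → mk⇔ (sub P Q z) (sub Q P z)
    where
    sub : ∀ {p q} → IsPair p x y → IsPair q x y → p ⊆ q
    sub (_ , _ , h) ((s , s∈ , S) , (d , d∈ , D) , _) z z∈ with h z z∈
    ... | inj₁ Z = ∈-respˡ (IsUnorderedPair-unique S Z) s∈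
    ... | inj₂ Z = ∈-respˡ (IsUnorderedPair-unique D Z) d∈

  IsPair-injective : ∀ {p x y x′ y′} → IsPair p x y → IsPair p x′ y′ → x ≈ x′ × y ≈ y′
  IsPair-injective P Q = fst P Q , case (snd P Q) (snd Q P) (fst P Q)
    where
    fst : ∀ {p x y x′ y′} → IsPair p x y → IsPair p x′ y′ → x ≈ x′
    fst ((s , s∈ , _ , _ , h) , _) (_ , _ , k) with k s s∈
    ... | inj₁ (x′∈ , _) with h _ x′∈
    ...   | inj₁ e = E.sym e
    ...   | inj₂ e = E.sym e
    fst ((s , s∈ , _ , _ , h) , _) (_ , _ , k) | inj₂ (x′∈ , _) with h _ x′∈
    ...   | inj₁ e = E.sym e
    ...   | inj₂ e = E.sym e
    snd : ∀ {p x y x′ y′} → IsPair p x y → IsPair p x′ y′ → y ≈ x′ ⊎ y ≈ y′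
    snd (_ , (d , d∈ , _ , y∈ , _) , _) (_ , _ , k) with k d d∈
    ... | inj₁ (_ , _ , h) with h _ y∈
    ...   | inj₁ e = inj₁ e
    ...   | inj₂ e = inj₁ e
    snd (_ , (d , d∈ , _ , y∈ , _) , _) (_ , _ , k) | inj₂ (_ , _ , h) = h _ y∈
    case : ∀ {x y x′ y′} → y ≈ x′ ⊎ y ≈ y′ → y′ ≈ x ⊎ y′ ≈ y → x ≈ x′ → y ≈ y′
    case (inj₂ e) _ _ = e
    case (inj₁ _) (inj₂ e) _ = E.sym e
    case (inj₁ e) (inj₁ e′) e″ = E.trans e (E.trans (E.sym e″) (E.sym e′))

  -- Cartesian products are bounded by iterating the set of unordered pairs.
  unorderedPairs : ∀ c → ∃[ q ] (∀ x y p → x ∈ c → y ∈ c → IsUnorderedPair p x y → p ∈ q)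
  unorderedPairs c = proj₁ (union (proj₁ rows)) , λ x y p x∈ y∈ P →
      from (proj₂ (union (proj₁ rows)) p)
        (proj₁ (row x x∈) ,
         from (proj₂ rows _) (x , x∈ , row-IsRow x x∈) ,
         from (proj₂ (row x x∈) p) (y , y∈ , P))
    where
    row : ∀ x → x ∈ c → ∃[ q ] (∀ p → p ∈ q ⇔ (∃[ y ] y ∈ c × IsUnorderedPair p x y))
    row x x∈ = replacement (⌜IsUnorderedPair⌝ v1 v2 v0) (x ∷ []) c (proj₁ (union c))
      (λ y _ → let p , P = unorderedPair x y in p , P , IsUnorderedPair-unique P)
      (λ y y∈ p (_ , _ , h) z z∈ w w∈ → from (proj₂ (union c) w) (bound x∈ y∈ (h z z∈) w∈))
      where
      bound : ∀ {y z w} → x ∈ c → y ∈ c → z ≈ x ⊎ z ≈ y → w ∈ z → ∃[ v ] v ∈ c × w ∈ v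
      bound x∈ y∈ (inj₁ e) w∈ = _ , x∈ , ∈-respʳ e w∈
      bound x∈ y∈ (inj₂ e) w∈ = _ , y∈ , ∈-respʳ e w∈

    IsRow : 𝐕 → 𝐕 → Set ℓ
    IsRow x q =
      (∀ p → p ∈ q → ∃[ y ] y ∈ c × IsUnorderedPair p x y) ×
      (∀ y → y ∈ c → ∃[ p ] p ∈ q × IsUnorderedPair p x y)

    row-IsRow : ∀ x x∈ → IsRow x (proj₁ (row x x∈))
    row-IsRow x x∈ =
      (λ p → to (proj₂ (row x x∈) p)) ,
      (λ y y∈ → let p , P = unorderedPair x y in
                p , from (proj₂ (row x x∈) p) (y , y∈ , P) , P)

    IsRow-⊆ : ∀ {x q r} → IsRow x q → IsRow x r → q ⊆ r
    IsRow-⊆ (h , _) (_ , k) p p∈ =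
      let y , y∈ , P = h p p∈
          p′ , p′∈ , P′ = k y y∈
      in ∈-respˡ (IsUnorderedPair-unique P′ P) p′∈

    rows : ∃[ s ] (∀ q → q ∈ s ⇔ (∃[ x ] x ∈ c × IsRow x q))
    rows = replacement
      (∀̇∈ v1 (∃̇∈ v3 (⌜IsUnorderedPair⌝ v1 v2 v0)) ∧̇
       ∀̇∈ v2 (∃̇∈ v2 (⌜IsUnorderedPair⌝ v0 v2 v1)))
      (c ∷ []) c c
      (λ x x∈ → proj₁ (row x x∈) , row-IsRow x x∈ , λ R →
         extensionality _ _ λ p →
           mk⇔ (IsRow-⊆ (row-IsRow x x∈) R p) (IsRow-⊆ R (row-IsRow x x∈) p))
      (λ x x∈ q (h , _) p p∈ z z∈ →
         let y , y∈ , _ , _ , k = h p p∈ in bound x∈ y∈ (k z z∈))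
      where
      bound : ∀ {x y z} → x ∈ c → y ∈ c → z ≈ x ⊎ z ≈ y → z ∈ c
      bound x∈ y∈ (inj₁ e) = ∈-respˡ (E.sym e) x∈
      bound x∈ y∈ (inj₂ e) = ∈-respˡ (E.sym e) y∈

  product-bound : ∀ a b → ∃[ q ] (∀ x y p → x ∈ a → y ∈ b → IsPair p x y → p ∈ q)
  product-bound a b =
    let ab , h = pairing a b
        c , k = union ab
        q , Q = unorderedPairs c
        r , R = unorderedPairs q
    in r , λ x y p x∈ y∈ ((s , s∈ , S) , (d , d∈ , D) , l) →
      let x∈c = from (k x) (a , from (h a) (inj₁ E.refl) , x∈)
          y∈c = from (k y) (b , from (h b) (inj₂ E.refl) , y∈)
      in R s d p (Q x x s x∈c x∈c S) (Q x y d x∈c y∈c D)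
           (s∈ , d∈ , λ z z∈ → case S D (l z z∈))
    where
    case : ∀ {x y s d z} → IsUnorderedPair s x x → IsUnorderedPair d x y →
           IsUnorderedPair z x x ⊎ IsUnorderedPair z x y → z ≈ s ⊎ z ≈ d
    case S D (inj₁ Z) = inj₁ (IsUnorderedPair-unique Z S)
    case S D (inj₂ Z) = inj₂ (IsUnorderedPair-unique Z D)

  record Function (a b : 𝐕) : Set ℓ where
    constructor mkFunction
    field
      graph      : 𝐕
      isFunction : IsFunction graph a b

    ap : ∀ x → x ∈ a → 𝐕
    ap x x∈ = proj₁ (proj₂ isFunction x x∈)

    ap-holds : ∀ x x∈ → Holds graph x (ap x x∈)
    ap-holds x x∈ = proj₁ (proj₂ (proj₂ isFunction x x∈))

    holds-∈ : ∀ {x y} → Holds graph x y → x ∈ a × y ∈ b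
    holds-∈ (p , p∈ , P) =
      let x , x∈ , y , y∈ , Q = proj₁ isFunction p p∈
          e , e′ = IsPair-injective Q P
      in ∈-respˡ e x∈ , ∈-respˡ e′ y∈

    ap-∈ : ∀ x x∈ → ap x x∈ ∈ b
    ap-∈ x x∈ = proj₂ (holds-∈ (ap-holds x x∈))

    holds-unique : ∀ {x y y′} → Holds graph x y → Holds graph x y′ → y ≈ y′
    holds-unique {x} H H′ =
      let u = proj₂ (proj₂ (proj₂ isFunction x (proj₁ (holds-∈ H))))
      in E.trans (E.sym (u H)) (u H′)

  open Function

  infix 4 _≐_

  _≐_ : ∀ {a b} → Rel (Function a b) ℓ
  f ≐ g = graph f ≈ graph g

  ≐-intro : ∀ {a b} (f g : Function a b) →
            (∀ x y → Holds (graph f) x y → Holds (graph g) x y) → f ≐ g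
  ≐-intro f g h = extensionality _ _ λ p → mk⇔ (sub f g h p) (sub g f h′ p)
    where
    sub : ∀ {a b} (f g : Function a b) →
          (∀ x y → Holds (graph f) x y → Holds (graph g) x y) → graph f ⊆ graph g
    sub f g h p p∈ =
      let x , _ , y , _ , P = proj₁ (isFunction f) p p∈
          q , q∈ , Q = h x y (p , p∈ , P)
      in ∈-respˡ (IsPair-unique Q P) q∈
    h′ : ∀ x y → Holds (graph g) x y → Holds (graph f) x y
    h′ x y H =
      let F = ap-holds f x (proj₁ (holds-∈ g H))
      in Holds-resp E.refl E.refl (holds-unique g (h _ _ F) H) F

  ≐-elim : ∀ {a b} {f g : Function a b} → f ≐ g →
           ∀ {x y} → Holds (graph f) x y → Holds (graph g) x y
  ≐-elim e = Holds-resp e E.refl E.refl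

  record Definable (a b : 𝐕) (P : 𝐕 → 𝐕 → Set ℓ) : Set ℓ where
    field
      function : Function a b
      spec     : ∀ x y → Holds (graph function) x y ⇔ (x ∈ a × y ∈ b × P x y)

  open Definable

  -- The function {(x , y) ∈ a × b ∣ φ}, where φ does not depend on its variable v2.
  module Definition
    (a b : 𝐕) {n} (ρ : Vec 𝐕 n) (φ : Δ₀ (suc (suc (suc (suc (suc n))))))
    (P : 𝐕 → 𝐕 → Set ℓ)
    (φ⇔P : ∀ p x y → (y ∷ x ∷ p ∷ b ∷ a ∷ ρ ⊨ φ) ⇔ P x y)
    (total : ∀ x → x ∈ a → ∃[ y ] y ∈ b × P x y)
    (functional : ∀ x y y′ → x ∈ a → y ∈ b → y′ ∈ b → P x y → P x y′ → y ≈ y′)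
    where

    private
      S : ∃[ f ] (∀ p → p ∈ f ⇔ (p ∈ proj₁ (product-bound a b) ×
            (∃[ x ] x ∈ a × (∃[ y ] y ∈ b × IsPair p x y × (y ∷ x ∷ p ∷ b ∷ a ∷ ρ ⊨ φ)))))
      S = separation (∃̇∈ v2 (∃̇∈ v2 (⌜IsPair⌝ v2 v1 v0 ∧̇ φ))) (b ∷ a ∷ ρ)
                     (proj₁ (product-bound a b))

      holds⇒ : ∀ x y → Holds (proj₁ S) x y → x ∈ a × y ∈ b × P x y
      holds⇒ x y (p , p∈ , Q) =
        let _ , x′ , x′∈ , y′ , y′∈ , Q′ , H = to (proj₂ S p) p∈
            e , e′ = IsPair-injective Q′ Q
        in ∈-respˡ e x′∈ , ∈-respˡ e′ y′∈ ,
           to (φ⇔P p x y) (⊨-resp-≈ φ (e′ ∷ e ∷ Pw.refl E.refl) H)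

      ⇒holds : ∀ x y → x ∈ a × y ∈ b × P x y → Holds (proj₁ S) x y
      ⇒holds x y (x∈ , y∈ , H) =
        let p , Q = pair x y in
        p , from (proj₂ S p) (proj₂ (product-bound a b) x y p x∈ y∈ Q ,
              x , x∈ , y , y∈ , Q , from (φ⇔P p x y) H) , Q

    abstract
      define : Definable a b P
      define = record
        { function = mkFunction (proj₁ S)
            ((λ p p∈ → let _ , x , x∈ , y , y∈ , Q , _ = to (proj₂ S p) p∈
                       in x , x∈ , y , y∈ , Q) ,
             (λ x x∈ → let y , y∈ , H = total x x∈ in
                y , ⇒holds x y (x∈ , y∈ , H) , λ {y′} H′ →
                  let _ , y′∈ , H″ = holds⇒ x y′ H′ in functional x y y′ x∈ y∈ y′∈ H H″))
        ; spec = λ x y → mk⇔ (holds⇒ x y) (⇒holds x y)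
        }

  open Definition using (define)

  identity : ∀ a → Definable a a (λ x y → y ≈ x)
  identity a = define a a [] (v0 ≈̇ v1) _
    (λ _ _ _ → mk⇔ id id)
    (λ x x∈ → x , x∈ , E.refl)
    (λ _ _ _ _ _ _ e e′ → E.trans e (E.sym e′))

  constant : ∀ a {b y₀} → y₀ ∈ b → Definable a b (λ x y → y ≈ y₀)
  constant a {b} {y₀} y₀∈b = define a b (y₀ ∷ []) (v0 ≈̇ v5) _
    (λ _ _ _ → mk⇔ id id)
    (λ _ _ → y₀ , y₀∈b , E.refl)
    (λ _ _ _ _ _ _ e e′ → E.trans e (E.sym e′))

  composite : ∀ {a b c} (g : Function b c) (f : Function a b) → Definable a c
    (λ x z → ∃[ y ] y ∈ b × Holds (graph f) x y × Holds (graph g) y z)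
  composite {a} {b} {c} g f = define a c (graph g ∷ graph f ∷ b ∷ [])
    (∃̇∈ v7 (⌜Holds⌝ v7 v2 v0 ∧̇ ⌜Holds⌝ v6 v0 v1)) _
    (λ _ _ _ → mk⇔ id id)
    (λ x x∈ → let y∈ = ap-∈ f x x∈ in
       ap g _ y∈ , ap-∈ g _ y∈ , _ , y∈ , ap-holds f x x∈ , ap-holds g _ y∈)
    (λ where _ _ _ _ _ _ (_ , _ , F , G) (_ , _ , F′ , G′) →
               holds-unique g G (Holds-resp E.refl (holds-unique f F′ F) E.refl G′))

  idF : ∀ {a} → Function a a
  idF {a} = function (identity a)

  infixr 9 _∘F_

  _∘F_ : ∀ {a b c} → Function b c → Function a b → Function a c
  g ∘F f = function (composite g f)

  ∘F-intro : ∀ {a b c} (g : Function b c) (f : Function a b) {x y z} →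
             Holds (graph f) x y → Holds (graph g) y z → Holds (graph (g ∘F f)) x z
  ∘F-intro g f F G = from (spec (composite g f) _ _)
    (proj₁ (holds-∈ f F) , proj₂ (holds-∈ g G) , _ , proj₁ (holds-∈ g G) , F , G)

  ∘F-elim : ∀ {a b c} (g : Function b c) (f : Function a b) {x z} →
            Holds (graph (g ∘F f)) x z → ∃[ y ] Holds (graph f) x y × Holds (graph g) y z
  ∘F-elim g f H =
    let _ , _ , y , _ , F , G = to (spec (composite g f) _ _) H in y , F , G

  idF-intro : ∀ {a x} → x ∈ a → Holds (graph (idF {a})) x x
  idF-intro {a} x∈ = from (spec (identity a) _ _) (x∈ , x∈ , E.refl)

  idF-elim : ∀ {a x y} → Holds (graph (idF {a})) x y → y ≈ x
  idF-elim {a} H = proj₂ (proj₂ (to (spec (identity a) _ _) H))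

  𝕊et : Category ℓ
  𝕊et = record
    { Obj       = 𝐕
    ; _⇒_       = Function
    ; _≈_       = _≐_
    ; idm       = idF
    ; _∘_       = _∘F_
    ; equiv     = record { refl = E.refl ; sym = E.sym ; trans = E.trans }
    ; assoc     = λ h g f → ≐-intro ((h ∘F g) ∘F f) (h ∘F (g ∘F f)) λ x y H →
        let _ , F , HG = ∘F-elim (h ∘F g) f H
            _ , G , H′ = ∘F-elim h g HG
        in ∘F-intro h (g ∘F f) (∘F-intro g f F G) H′
    ; identityˡ = λ f → ≐-intro (idF ∘F f) f λ x y H →
        let _ , F , I = ∘F-elim idF f H
        in Holds-resp E.refl E.refl (E.sym (idF-elim I)) F
    ; identityʳ = λ f → ≐-intro (f ∘F idF) f λ x y H →
        let _ , I , F = ∘F-elim f idF H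
        in Holds-resp E.refl (idF-elim I) E.refl F
    ; ∘-resp-≈  = λ {_} {_} {_} {g} {g′} {f} {f′} e e′ →
        ≐-intro (g ∘F f) (g′ ∘F f′) λ x y H →
          let _ , F , G = ∘F-elim g f H
          in ∘F-intro g′ f′ (≐-elim {f = f} {f′} e′ F) (≐-elim {f = g} {g′} e G)
    }

  ∅ : 𝐕
  ∅ = proj₁ emptySet

  one : 𝐕
  one = proj₁ (unorderedPair ∅ ∅)

  ∅∈one : ∅ ∈ one
  ∅∈one = proj₁ (proj₂ (unorderedPair ∅ ∅))

  ∈one⇒≈∅ : ∀ {x} → x ∈ one → x ≈ ∅
  ∈one⇒≈∅ x∈ with proj₂ (proj₂ (proj₂ (unorderedPair ∅ ∅))) _ x∈
  ... | inj₁ e = e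
  ... | inj₂ e = e

  terminal : Terminal 𝕊et
  terminal = record
    { 𝟙        = one
    ; !        = λ a → function (constant a ∅∈one)
    ; !-unique = λ {a} f → ≐-intro f (function (constant a ∅∈one)) λ x y F →
        let x∈ , y∈ = holds-∈ f F
        in from (spec (constant a ∅∈one) x y) (x∈ , y∈ , ∈one⇒≈∅ y∈)
    }

  -- The element of a named by a global element of a.
  value : ∀ {a} → Function one a → 𝐕
  value f = ap f ∅ ∅∈one

  value-holds : ∀ {a} (f : Function one a) → Holds (graph f) ∅ (value f)
  value-holds f = ap-holds f ∅ ∅∈one

  module Naturals (infinity : Infinity) (exponentials : Exponentials) where

    ω : 𝐕
    ω = proj₁ infinity

    successor : ∀ x → ∃[ y ] IsSuccessor x y
    successor x =
      let s , _ , x∈s , S = unorderedPair x x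
          p , P = pairing x s
          y , Y = union p
          in-x : ∀ {z} → z ∈ x → z ∈ y
          in-x z∈ = from (Y _) (x , from (P x) (inj₁ E.refl) , z∈)
          in-s : ∀ {z} → z ∈ s → z ∈ y
          in-s z∈ = from (Y _) (s , from (P s) (inj₂ E.refl) , z∈)
      in y , (λ z → in-x) , in-s x∈s , λ z z∈ →
         let w , w∈ , z∈w = to (Y z) z∈ in split S z∈w (to (P w) w∈)
      where
      split : ∀ {s z w} → (∀ z → z ∈ s → z ≈ x ⊎ z ≈ x) → z ∈ w → w ≈ x ⊎ w ≈ s →
              z ∈ x ⊎ z ≈ x
      split S z∈ (inj₁ e) = inj₁ (∈-respʳ e z∈)
      split S z∈ (inj₂ e) with S _ (∈-respʳ e z∈)
      ... | inj₁ e′ = inj₂ e′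
      ... | inj₂ e′ = inj₂ e′

    IsSuccessor-unique : ∀ {x y y′} → IsSuccessor x y → IsSuccessor x y′ → y ≈ y′
    IsSuccessor-unique {x} S S′ = extensionality _ _ λ z → mk⇔ (sub S S′ z) (sub S′ S z)
      where
      sub : ∀ {y y′} → IsSuccessor x y → IsSuccessor x y′ → y ⊆ y′
      sub (_ , _ , h) (k , x∈ , _) z z∈ with h z z∈
      ... | inj₁ z∈x = k z z∈x
      ... | inj₂ e = ∈-respˡ (E.sym e) x∈

    IsSuccessor-resp : ∀ {x x′ y y′} → x ≈ x′ → y ≈ y′ → IsSuccessor x y → IsSuccessor x′ y′
    IsSuccessor-resp e e′ = ⊨-resp-≈ (⌜IsSuccessor⌝ v0 v1) {_ ∷ _ ∷ []} {_ ∷ _ ∷ []} (e ∷ e′ ∷ [])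

    ∅∈ω : ∅ ∈ ω
    ∅∈ω = proj₁ (proj₁ (proj₂ infinity)) ∅ (proj₂ emptySet)

    successor∈ω : ∀ {n m} → n ∈ ω → IsSuccessor n m → m ∈ ω
    successor∈ω n∈ = proj₂ (proj₁ (proj₂ infinity)) _ n∈ _

    IsEmpty⇒≈∅ : ∀ {x} → IsEmpty x → x ≈ ∅
    IsEmpty⇒≈∅ h = extensionality _ _ λ z →
      mk⇔ (λ z∈ → ⊥-elim (h z z∈)) (λ z∈ → ⊥-elim (proj₂ emptySet z z∈))

    ω-induction : ∀ {n} (φ : Δ₀ (suc n)) (ρ : Vec 𝐕 n) → ∅ ∷ ρ ⊨ φ →
      (∀ x y → x ∈ ω → IsSuccessor x y → x ∷ ρ ⊨ φ → y ∷ ρ ⊨ φ) →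
      ∀ x → x ∈ ω → x ∷ ρ ⊨ φ
    ω-induction φ ρ base step x x∈ = proj₂ (to (proj₂ S x) (proj₂ (proj₂ infinity) (proj₁ S)
        ((λ e h → from (proj₂ S e)
            (∈-respˡ (E.sym (IsEmpty⇒≈∅ h)) ∅∈ω ,
             ⊨-resp-≈ φ (E.sym (IsEmpty⇒≈∅ h) ∷ Pw.refl E.refl) base)) ,
         (λ y y∈ z Z → let y∈ω , H = to (proj₂ S y) y∈ in
            from (proj₂ S z) (successor∈ω y∈ω Z , step y z y∈ω Z H)))
        x x∈))
      where
      S = separation φ ρ ω

    ω-transitive : ∀ n → n ∈ ω → ∀ k m → k ∈ m → m ∈ n → k ∈ n
    ω-transitive n n∈ k m k∈ m∈ =
      ω-induction (∀̇∈ v0 (⌜⊆⌝ v0 v1)) []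
        (λ x x∈ → ⊥-elim (proj₂ emptySet x x∈))
        (λ x y _ (x⊆ , _ , h) H m m∈ k k∈ → x⊆ k (below H (h m m∈) k∈))
        n n∈ m m∈ k k∈
      where
      below : ∀ {x m k} → Transitive x → m ∈ x ⊎ m ≈ x → k ∈ m → k ∈ x
      below H (inj₁ m∈) k∈ = H _ m∈ _ k∈
      below H (inj₂ e) k∈ = ∈-respʳ e k∈

    ω-members : ∀ n → n ∈ ω → n ⊆ ω
    ω-members = ω-induction (⌜⊆⌝ v0 v1) (ω ∷ [])
      (λ x x∈ → ⊥-elim (proj₂ emptySet x x∈))
      (λ x y x∈ S H z z∈ → split x∈ H (proj₂ (proj₂ S) z z∈))
      where
      split : ∀ {x z} → x ∈ ω → x ⊆ ω → z ∈ x ⊎ z ≈ x → z ∈ ω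
      split x∈ H (inj₁ z∈) = H _ z∈
      split x∈ H (inj₂ e) = ∈-respˡ (E.sym e) x∈

    ω-irreflexive : ∀ n → n ∈ ω → n ∈ n → ⊥ {ℓ}
    ω-irreflexive = ω-induction (v0 ∈̇ v0 ⇒̇ ⊥̇) []
      (λ h → ⊥-elim (proj₂ emptySet _ h))
      (λ x y x∈ω S H y∈y → H (loop (ω-transitive x x∈ω _ _) S (proj₂ (proj₂ S) y y∈y)))
      where
      loop : ∀ {x y} → (∀ {k m} → k ∈ m → m ∈ x → k ∈ x) → IsSuccessor x y →
             y ∈ x ⊎ y ≈ x → x ∈ x
      loop t (_ , x∈y , _) (inj₁ y∈x) = t x∈y y∈x
      loop t (_ , x∈y , _) (inj₂ e) = ∈-respʳ e x∈y

    predecessor-unique : ∀ {k k′ n} → k ∈ ω → IsSuccessor k n → IsSuccessor k′ n → k ≈ k′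
    predecessor-unique k∈ω (_ , k∈n , h) (_ , k′∈n , h′) with h′ _ k∈n
    ... | inj₂ e = e
    ... | inj₁ k∈k′ with h _ k′∈n
    ...   | inj₂ e = E.sym e
    ...   | inj₁ k′∈k with ω-irreflexive _ k∈ω (ω-transitive _ k∈ω _ _ k∈k′ k′∈k)
    ...     | ()

    ∅-not-successor : ∀ {k n} → IsSuccessor k n → n ≈ ∅ → ⊥ {ℓ}
    ∅-not-successor (_ , k∈n , _) e = ⊥-elim (proj₂ emptySet _ (∈-respʳ e k∈n))

    zero-or-successor : ∀ n → n ∈ ω → n ≈ ∅ ⊎ (∃[ k ] k ∈ ω × IsSuccessor k n)
    zero-or-successor = ω-induction
      (v0 ≈̇ v1 ∨̇ ∃̇∈ v2 (⌜IsSuccessor⌝ v0 v1)) (∅ ∷ ω ∷ [])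
      (inj₁ E.refl) (λ x y x∈ S _ → inj₂ (x , x∈ , S))

    zeroF : Function one ω
    zeroF = function (constant one ∅∈ω)

    succession : Definable ω ω IsSuccessor
    succession = define ω ω [] (⌜IsSuccessor⌝ v1 v0) _
      (λ _ _ _ → mk⇔ id id)
      (λ n n∈ → let m , S = successor n in m , successor∈ω n∈ S , S)
      (λ _ _ _ _ _ _ → IsSuccessor-unique)

    succF : Function ω ω
    succF = function succession

    module Iteration {a : 𝐕} (base : Function one a) (step : Function a a) where

      private
        a₀ : 𝐕
        a₀ = value base

        a₀∈a : a₀ ∈ a
        a₀∈a = ap-∈ base ∅ ∅∈one

        T : 𝐕 → 𝐕 → Set ℓ
        T = Holds (graph step)

        a^ω : 𝐕
        a^ω = proj₁ (exponentials ω a)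

        fun : ∀ {g} → g ∈ a^ω → Function ω a
        fun {g} g∈ = mkFunction g (to (proj₂ (exponentials ω a) g) g∈)

        fun-∈ : (g : Function ω a) → graph g ∈ a^ω
        fun-∈ g = from (proj₂ (exponentials ω a) (graph g)) (isFunction g)

        -- g satisfies the recursion equations up to n.
        Good : 𝐕 → 𝐕 → Set ℓ
        Good n g = Holds g ∅ a₀ ×
          (∀ m → m ∈ n → ∀ l → l ∈ ω → IsSuccessor m l →
            ∃[ x ] x ∈ a × (∃[ y ] y ∈ a × Holds g m x × T x y × Holds g l y))

        ⌜Good⌝ : ∀ {n} → Fin n → Fin n → (a ω t e a₀ : Fin n) → Δ₀ n
        ⌜Good⌝ n g a w t e a₀ = ⌜Holds⌝ g e a₀ ∧̇
          ∀̇∈ n (∀̇∈ (suc w) (⌜IsSuccessor⌝ v1 v0 ⇒̇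
            ∃̇∈ (suc (suc a)) (∃̇∈ (suc (suc (suc a)))
              (⌜Holds⌝ (suc (suc (suc (suc g)))) v3 v1 ∧̇
               ⌜Holds⌝ (suc (suc (suc (suc t)))) v1 v0 ∧̇
               ⌜Holds⌝ (suc (suc (suc (suc g)))) v2 v0))))

        -- shift g sends ∅ to a₀ and k ∪ {k} to step (g k).
        Shifted : 𝐕 → 𝐕 → 𝐕 → Set ℓ
        Shifted g m x = (m ≈ ∅ × x ≈ a₀) ⊎
          (∃[ k ] k ∈ ω × IsSuccessor k m × (∃[ y ] y ∈ a × Holds g k y × T y x))

        shift : (g : Function ω a) → Definable ω a (Shifted (graph g))
        shift g = define ω a (∅ ∷ a₀ ∷ graph g ∷ graph step ∷ [])
          (v1 ≈̇ v5 ∧̇ v0 ≈̇ v6 ∨̇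
           ∃̇∈ v4 (⌜IsSuccessor⌝ v0 v2 ∧̇
             ∃̇∈ (suc v3) (⌜Holds⌝ v9 v1 v0 ∧̇ ⌜Holds⌝ (suc v9) v0 v2)))
          _
          (λ _ _ _ → mk⇔ id id)
          (λ m m∈ → total (zero-or-successor m m∈))
          (λ _ _ _ _ _ _ → functional)
          where
          total : ∀ {m} → m ≈ ∅ ⊎ (∃[ k ] k ∈ ω × IsSuccessor k m) →
                  ∃[ x ] x ∈ a × Shifted (graph g) m x
          total (inj₁ e) = a₀ , a₀∈a , inj₁ (e , E.refl)
          total (inj₂ (k , k∈ , S)) =
            let y∈ = ap-∈ g k k∈ in
            ap step _ y∈ , ap-∈ step _ y∈ ,
            inj₂ (k , k∈ , S , _ , y∈ , ap-holds g k k∈ , ap-holds step _ y∈)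
          functional : ∀ {m x x′} → Shifted (graph g) m x → Shifted (graph g) m x′ → x ≈ x′
          functional (inj₁ (_ , e)) (inj₁ (_ , e′)) = E.trans e (E.sym e′)
          functional (inj₁ (e , _)) (inj₂ (_ , _ , S , _)) with ∅-not-successor S e
          ... | ()
          functional (inj₂ (_ , _ , S , _)) (inj₁ (e , _)) with ∅-not-successor S e
          ... | ()
          functional (inj₂ (k , k∈ , S , y , _ , G , H)) (inj₂ (k′ , _ , S′ , y′ , _ , G′ , H′)) =
            holds-unique step H (Holds-resp E.refl
              (holds-unique g (Holds-resp E.refl (E.sym (predecessor-unique k∈ S S′)) E.refl G′) G)
              E.refl H′)

        ∈-predecessor : ∀ {k m n} → n ∈ ω → IsSuccessor k m → m ∈ n ⊎ m ≈ n → k ∈ n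
        ∈-predecessor n∈ (_ , k∈m , _) (inj₁ m∈n) = ω-transitive _ n∈ _ _ k∈m m∈n
        ∈-predecessor n∈ (_ , k∈m , _) (inj₂ e) = ∈-respʳ e k∈m

        shift-Good : ∀ {n n′} (g : Function ω a) → n ∈ ω → IsSuccessor n n′ →
                     Good n (graph g) → Good n′ (graph (function (shift g)))
        shift-Good {n} {n′} g n∈ S (g-zero , g-step) =
          from (spec (shift g) _ _) (∅∈ω , a₀∈a , inj₁ (E.refl , E.refl)) ,
          λ m m∈ l l∈ L →
            let m∈ω = ω-members _ (successor∈ω n∈ S) m m∈
                x , x∈ , G , H = agree m m∈ω (proj₂ (proj₂ S) m m∈) (zero-or-successor m m∈ω)
                y∈ = ap-∈ step x x∈
                Y = ap-holds step x x∈
            in x , x∈ , _ , y∈ , H , Y ,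
               from (spec (shift g) _ _) (l∈ , y∈ , inj₂ (m , m∈ω , L , x , x∈ , G , Y))
          where
          agree : ∀ m → m ∈ ω → m ∈ n ⊎ m ≈ n → m ≈ ∅ ⊎ (∃[ k ] k ∈ ω × IsSuccessor k m) →
            ∃[ x ] x ∈ a × Holds (graph g) m x × Holds (graph (function (shift g))) m x
          agree m m∈ω _ (inj₁ e) =
            a₀ , a₀∈a , Holds-resp E.refl (E.sym e) E.refl g-zero ,
            from (spec (shift g) _ _) (m∈ω , a₀∈a , inj₁ (e , E.refl))
          agree m m∈ω c (inj₂ (k , k∈ω , K)) =
            let x , x∈ , y , y∈ , G , Y , G′ = g-step k (∈-predecessor n∈ K c) m m∈ω K
            in y , y∈ , G′ ,
               from (spec (shift g) _ _) (m∈ω , y∈ , inj₂ (k , k∈ω , K , x , x∈ , G , Y))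

        Good-exists : ∀ n → n ∈ ω → ∃[ g ] g ∈ a^ω × Good n g
        Good-exists = ω-induction (∃̇∈ v1 (⌜Good⌝ v1 v0 v3 v4 v5 v6 v7))
          (a^ω ∷ a ∷ ω ∷ graph step ∷ ∅ ∷ a₀ ∷ [])
          (let c = constant ω a₀∈a in
           graph (function c) , fun-∈ (function c) ,
           from (spec c _ _) (∅∈ω , a₀∈a , E.refl) ,
           λ m m∈ → ⊥-elim (proj₂ emptySet m m∈))
          (λ where n n′ n∈ S (g , g∈ , G) →
                     let h = function (shift (fun g∈))
                     in graph h , fun-∈ h , shift-Good (fun g∈) n∈ S G)

        Good-agree : ∀ {n g g′} → n ∈ ω → g ∈ a^ω → g′ ∈ a^ω → Good n g → Good n g′ →
          ∀ m → m ∈ ω → m ∈ n ⊎ m ≈ n → ∃[ x ] x ∈ a × Holds g m x × Holds g′ m x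
        Good-agree {n} {g} {g′} n∈ g∈ g′∈ (z , s) (z′ , s′) = ω-induction
          (v0 ∈̇ v1 ∨̇ v0 ≈̇ v1 ⇒̇ ∃̇∈ v4 (⌜Holds⌝ v3 v1 v0 ∧̇ ⌜Holds⌝ v4 v1 v0))
          (n ∷ g ∷ g′ ∷ a ∷ [])
          (λ _ → a₀ , a₀∈a , z , z′)
          (λ k m k∈ K IH c →
            let k∈n = ∈-predecessor n∈ K c
                m∈ω = successor∈ω k∈ K
                x , _ , G , G′ = IH (inj₁ k∈n)
                x₁ , _ , y₁ , y₁∈ , G₁ , T₁ , H₁ = s k k∈n m m∈ω K
                x₂ , _ , y₂ , y₂∈ , G₂ , T₂ , H₂ = s′ k k∈n m m∈ω K
                x₂≈x₁ = E.trans (holds-unique (fun g′∈) G₂ G′) (holds-unique (fun g∈) G G₁)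
                y₂≈y₁ = holds-unique step (Holds-resp E.refl x₂≈x₁ E.refl T₂) T₁
            in y₁ , y₁∈ , H₁ , Holds-resp E.refl E.refl y₂≈y₁ H₂)

        Iterated : 𝐕 → 𝐕 → Set ℓ
        Iterated n x = ∃[ g ] g ∈ a^ω × Good n g × Holds g n x

        iteration : Definable ω a Iterated
        iteration = define ω a (a^ω ∷ graph step ∷ ∅ ∷ a₀ ∷ [])
          (∃̇∈ v5 (⌜Good⌝ v2 v0 v4 v5 v7 v8 v9 ∧̇ ⌜Holds⌝ v0 v2 v1))
          _
          (λ _ _ _ → mk⇔ id id)
          (λ n n∈ → let g , g∈ , G = Good-exists n n∈ in
             ap (fun g∈) n n∈ , ap-∈ (fun g∈) n n∈ , g , g∈ , G , ap-holds (fun g∈) n n∈)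
          (λ where n x x′ n∈ _ _ (g , g∈ , G , H) (g′ , g′∈ , G′ , H′) →
                     let y , _ , Y , Y′ = Good-agree n∈ g∈ g′∈ G G′ n n∈ (inj₂ E.refl)
                     in E.trans (holds-unique (fun g∈) H Y) (holds-unique (fun g′∈) Y′ H′))

      iterF : Function ω a
      iterF = function iteration

      iterF-zero : iterF ∘F zeroF ≐ base
      iterF-zero = ≐-intro (iterF ∘F zeroF) base λ u x H →
        let n , Z , I = ∘F-elim iterF zeroF H
            _ , _ , n≈∅ = to (spec (constant one ∅∈ω) u n) Z
            _ , _ , g , g∈ , (G , _) , H′ = to (spec iteration n x) I
        in Holds-resp E.refl (E.sym (∈one⇒≈∅ (proj₁ (holds-∈ zeroF Z))))
             (holds-unique (fun g∈) G (Holds-resp E.refl n≈∅ E.refl H′))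
             (value-holds base)

      iterF-succ : iterF ∘F succF ≐ step ∘F iterF
      iterF-succ = ≐-intro (iterF ∘F succF) (step ∘F iterF) λ n x H →
        let m , Z , I = ∘F-elim iterF succF H
            n∈ , m∈ , S = to (spec succession n m) Z
            _ , _ , g , g∈ , (z , s) , H′ = to (spec iteration m x) I
            x₁ , x₁∈ , y₁ , _ , G₁ , T₁ , G₂ = s n (proj₁ (proj₂ S)) m m∈ S
        in ∘F-intro step iterF
             (from (spec iteration n x₁)
               (n∈ , x₁∈ , g , g∈ , (z , λ k k∈ → s k (proj₁ S k k∈)) , G₁))
             (Holds-resp E.refl E.refl (holds-unique (fun g∈) G₂ H′) T₁)

      private
        solution-zero : (h : Function ω a) → h ∘F zeroF ≐ base → Holds (graph h) ∅ a₀
        solution-zero h e =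
          let n , Z , H = ∘F-elim h zeroF
                (≐-elim {f = base} {h ∘F zeroF} (E.sym e) (value-holds base))
          in Holds-resp E.refl (proj₂ (proj₂ (to (spec (constant one ∅∈ω) ∅ n) Z))) E.refl H

        solution-succ : (h : Function ω a) → h ∘F succF ≐ step ∘F h →
          ∀ {n m x y} → IsSuccessor n m → Holds (graph h) n x → T x y → Holds (graph h) m y
        solution-succ h e {n} S H t =
          let m , Z , H′ = ∘F-elim h succF
                (≐-elim {f = step ∘F h} {h ∘F succF} (E.sym e) (∘F-intro step h H t))
          in Holds-resp E.refl
               (IsSuccessor-unique (proj₂ (proj₂ (to (spec succession n m) Z))) S) E.refl H′

      iterF-unique : (h : Function ω a) → h ∘F zeroF ≐ base → h ∘F succF ≐ step ∘F h →
                     h ≐ iterF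
      iterF-unique h e e′ = ≐-intro h iterF λ n y H →
          let x , _ , H′ , I = agree n (proj₁ (holds-∈ h H))
          in Holds-resp E.refl E.refl (holds-unique h H′ H) I
        where
        agree : ∀ n → n ∈ ω → ∃[ x ] x ∈ a × Holds (graph h) n x × Holds (graph iterF) n x
        agree = ω-induction (∃̇∈ v3 (⌜Holds⌝ v2 v1 v0 ∧̇ ⌜Holds⌝ v3 v1 v0))
          (graph h ∷ graph iterF ∷ a ∷ [])
          (a₀ , a₀∈a , solution-zero h e , solution-zero iterF iterF-zero)
          (λ where n m _ S (x , x∈ , H , I) →
                     let t = ap-holds step x x∈ in
                     ap step x x∈ , ap-∈ step x x∈ ,
                     solution-succ h e′ S H t , solution-succ iterF iterF-succ S I t)

    open Iteration

    nno : NNO 𝕊et terminal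
    nno = record
      { N         = ω
      ; z         = zeroF
      ; s         = succF
      ; iter      = iterF
      ; iter-z    = iterF-zero
      ; iter-s    = iterF-succ
      ; iter-uniq = iterF-unique
      }

    open Graphs 𝕊et terminal nno using (WFExtAPG; 𝕍) public

    -- G is the transitive closure of {x}, with membership as its relation and x
    -- as its root.
    record IsMembershipGraph (x : 𝐕) (G : WFExtAPG) : Set ℓ where
      open WFExtAPG G
      field
        contains   : x ∈ X
        transitive : Transitive X
        least      : ∀ t → x ∈ t → Transitive t → X ⊆ t
        membership : ∀ u v → u ≺ v ⇔ value u ∈ value v
        root       : value ⋆ ≈ x

open Axioms public

-- A set x is coded by the transitive closure of {x} with membership as its relation and x
-- as its root. It is well-founded by foundation and extensional by extensionality. It is
-- accessible because the elements with a path to x form a transitive set containing x; this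
-- is a set since a path is a function on ω, so that having a path to x is Δ₀.
-- If x ∈ y, the inclusion of transitive closures exhibits the code of x as a slice of the
-- code of y. Conversely, a slice of the code of y isomorphic to the code of x yields an
-- embedding of one transitive set onto an initial part of another, which by foundation moves
-- nothing, so x is a member of y.
-- Mostowski's principle collapses every graph to a transitive set, in which the transitive
-- closure of the image of the root is everything by accessibility. For the converse, adjoin
-- a root above all elements of a well-founded extensional relation: the set coded by the
-- resulting graph is the required transitive set.
module Submission where

open import Data.Empty using (⊥-elim)
open import Data.Empty.Polymorphic as Polymorphic using (⊥)
open import Data.Fin.Base using (suc)
open import Data.Nat.Base using (suc)
open import Data.Product.Base using (Σ-syntax; ∃-syntax; _×_; _,_; proj₁; proj₂)
open import Data.Sum.Base using (_⊎_; inj₁; inj₂)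
open import Data.Vec.Base using (Vec; []; _∷_)
open import Data.Vec.Relation.Binary.Pointwise.Inductive as Pw using (_∷_)
open import Function.Base using (id)
open import Function.Bundles using (_⇔_; mk⇔; module Equivalence)
open import Relation.Binary.Morphism.Structures using (IsOrderMonomorphism; IsOrderIsomorphism)
open import Relation.Binary.Structures using (IsEquivalence)
open import Defs using (∈-Structure; Δ₀; _∈̇_; _≈̇_; ⊥̇; _∧̇_; _∨̇_; _⇒̇_; ∀̇∈; ∃̇∈;
  Category; Terminal; NNO; module Axioms; module Sets; module Category; module Graphs)

open Equivalence using (to; from)

-- Objects and global elements are read as sets through ob and val. A statement about a
-- category that merely computes to 𝕊et can then be moved to 𝕊et by comparing the two
-- categories once, instead of comparing all their composites.
module Canonical {ℓ} (V : ∈-Structure ℓ) (𝒞 : Category ℓ) (𝒯 : Terminal 𝒞) (𝒩 : NNO 𝒞 𝒯)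
  (ob : Category.Obj 𝒞 → ∈-Structure.Carrier V)
  (val : ∀ {a} → Category._⇒_ 𝒞 (Terminal.𝟙 𝒯) a → ∈-Structure.Carrier V) where

  open ∈-Structure V renaming (Carrier to 𝐕)
  open Axioms V
  open Graphs 𝒞 𝒯 𝒩
  private
    module 𝕍 = ∈-Structure 𝕍

  record MembershipGraph (x : 𝐕) (G : WFExtAPG) : Set ℓ where
    open WFExtAPG G
    field
      contains   : x ∈ ob X
      transitive : Transitive (ob X)
      least      : ∀ t → x ∈ t → Transitive t → ob X ⊆ t
      membership : ∀ u v → u ≺ v ⇔ val u ∈ val v
      root       : val ⋆ ≈ x

  record CanonicalEmbedding : Set ℓ where
    field
      embed        : 𝐕 → WFExtAPG
      monomorphism : IsOrderMonomorphism _≈_ 𝕍._≈_ _∈_ 𝕍._∈_ embed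
      isMembership : ∀ x → MembershipGraph x (embed x)
      isomorphism  : IsOrderIsomorphism _≈_ 𝕍._≈_ _∈_ 𝕍._∈_ embed ⇔ Mostowski

module Embedding {ℓ} (V : ∈-Structure ℓ) (core : Axioms.CoreAxioms V)
  (infinity : Axioms.Infinity V) (exponentials : Axioms.Exponentials V)
  (foundation : Axioms.Foundation V) (transitiveClosure : Axioms.TransitiveClosures V) where

  open ∈-Structure V renaming (Carrier to 𝐕)
  open Axioms V
  open CoreAxioms core
  open Sets V core
  open Naturals infinity exponentials hiding (WFExtAPG; 𝕍)
  open Function
  open Definable
  open Definition using (define)
  private
    module E = IsEquivalence isEquivalence

  -- Functions, inclusions and relations as sets.

  Injective : ∀ {a b} → Function a b → Set ℓ
  Injective f = ∀ x x′ y → Holds (graph f) x y → Holds (graph f) x′ y → x ≈ x′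

  Surjective : ∀ {a b} → Function a b → Set ℓ
  Surjective {b = b} f = ∀ y → y ∈ b → ∃[ x ] Holds (graph f) x y

  inverse : ∀ {a b} (f : Function a b) → Injective f → Surjective f →
            Definable b a (λ y x → Holds (graph f) x y)
  inverse {a} {b} f inj sur = define b a (graph f ∷ []) (⌜Holds⌝ v5 v0 v1) _
    (λ _ _ _ → mk⇔ id id)
    (λ y y∈ → let x , F = sur y y∈ in x , proj₁ (holds-∈ f F) , F)
    (λ y x x′ _ _ _ F F′ → inj x x′ y F F′)

  inclusion : ∀ {a b} → a ⊆ b → Definable a b (λ x y → y ≈ x)
  inclusion {a} {b} a⊆b = define a b [] (v0 ≈̇ v1) _
    (λ _ _ _ → mk⇔ id id)
    (λ x x∈ → x , a⊆b x x∈ , E.refl)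
    (λ _ _ _ _ _ _ e e′ → E.trans e (E.sym e′))

  include : ∀ {a b} → a ⊆ b → Function a b
  include a⊆b = function (inclusion a⊆b)

  include-intro : ∀ {a b x} (a⊆b : a ⊆ b) → x ∈ a → Holds (graph (include a⊆b)) x x
  include-intro {x = x} a⊆b x∈ = from (spec (inclusion a⊆b) x x) (x∈ , a⊆b x x∈ , E.refl)

  include-elim : ∀ {a b x y} (a⊆b : a ⊆ b) → Holds (graph (include a⊆b)) x y → y ≈ x
  include-elim a⊆b H = proj₂ (proj₂ (to (spec (inclusion a⊆b) _ _) H))

  include-injective : ∀ {a b} (a⊆b : a ⊆ b) → Injective (include a⊆b)
  include-injective a⊆b x x′ y H H′ =
    E.trans (E.sym (include-elim a⊆b H)) (include-elim a⊆b H′)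

  -- As in Definition, φ must not depend on its variable v2.
  abstract
    private
      product : ∀ a b → ∃[ q ] (∀ x y p → x ∈ a → y ∈ b → IsPair p x y → p ∈ q)
      product = product-bound

    relation : ∀ a b {n} (ρ : Vec 𝐕 n) (φ : Δ₀ (suc (suc (suc (suc (suc n))))))
      (P : 𝐕 → 𝐕 → Set ℓ) →
      (∀ p x y → (y ∷ x ∷ p ∷ b ∷ a ∷ ρ ⊨ φ) ⇔ P x y) →
      ∃[ r ] IsRelation r a b × (∀ x y → Holds r x y ⇔ (x ∈ a × y ∈ b × P x y))
    relation a b ρ φ P φ⇔P =
      proj₁ S ,
      (λ p p∈ → let _ , x , x∈ , y , y∈ , Q , _ = to (proj₂ S p) p∈
                in x , x∈ , y , y∈ , Q) ,
      λ x y → mk⇔ (holds⇒ x y) (⇒holds x y)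
      where
      S : ∃[ r ] (∀ p → p ∈ r ⇔ (p ∈ proj₁ (product a b) ×
            (∃[ x ] x ∈ a × (∃[ y ] y ∈ b × IsPair p x y × (y ∷ x ∷ p ∷ b ∷ a ∷ ρ ⊨ φ)))))
      S = separation (∃̇∈ v2 (∃̇∈ v2 (⌜IsPair⌝ v2 v1 v0 ∧̇ φ))) (b ∷ a ∷ ρ)
            (proj₁ (product a b))
      holds⇒ : ∀ x y → Holds (proj₁ S) x y → x ∈ a × y ∈ b × P x y
      holds⇒ x y (p , p∈ , Q) =
        let _ , x′ , x′∈ , y′ , y′∈ , Q′ , H = to (proj₂ S p) p∈
            e , e′ = IsPair-injective Q′ Q
        in ∈-respˡ e x′∈ , ∈-respˡ e′ y′∈ ,
           to (φ⇔P p x y) (⊨-resp-≈ φ (e′ ∷ e ∷ Pw.refl E.refl) H)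
      ⇒holds : ∀ x y → x ∈ a × y ∈ b × P x y → Holds (proj₁ S) x y
      ⇒holds x y (x∈ , y∈ , H) =
        let p , Q = pair x y
        in p , from (proj₂ S p) (proj₂ (product a b) x y p x∈ y∈ Q ,
             x , x∈ , y , y∈ , Q , from (φ⇔P p x y) H) , Q

  relation-∈ : ∀ {r a b x y} → IsRelation r a b → Holds r x y → x ∈ a × y ∈ b
  relation-∈ R (p , p∈ , P) =
    let x , x∈ , y , y∈ , Q = R p p∈
        e , e′ = IsPair-injective Q P
    in ∈-respˡ e x∈ , ∈-respˡ e′ y∈

  -- The order on `ω`.

  infix 4 _⊑_

  _⊑_ : 𝐕 → 𝐕 → Set ℓ
  m ⊑ n = m ∈ n ⊎ m ≈ n

  ⊑⇒∈successor : ∀ {m n n′} → m ⊑ n → IsSuccessor n n′ → m ∈ n′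
  ⊑⇒∈successor (inj₁ m∈n) S = proj₁ S _ m∈n
  ⊑⇒∈successor (inj₂ e) S = ∈-respˡ (E.sym e) (proj₁ (proj₂ S))

  ∈-⊑-trans : ∀ {k m n} → n ∈ ω → k ∈ m → m ⊑ n → k ∈ n
  ∈-⊑-trans n∈ k∈m (inj₁ m∈n) = ω-transitive _ n∈ _ _ k∈m m∈n
  ∈-⊑-trans n∈ k∈m (inj₂ e) = ∈-respʳ e k∈m

  ∅⊑ : ∀ n → n ∈ ω → ∅ ⊑ n
  ∅⊑ = ω-induction (v1 ∈̇ v0 ∨̇ v1 ≈̇ v0) (∅ ∷ []) (inj₂ E.refl)
    (λ _ _ _ S h → inj₁ (⊑⇒∈successor h S))

  -- Induction on `n`: a member `m` of `n ∪ {n}` either lies in `n`, where the induction hypothesis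
  -- applies, or equals `n`, and then the two successors coincide. Letting `m′` range over `ω` keeps
  -- the induction formula Δ₀.
  ∈⇒successor⊑ : ∀ n → n ∈ ω → ∀ m → m ∈ n → ∀ m′ → m′ ∈ ω → IsSuccessor m m′ → m′ ⊑ n
  ∈⇒successor⊑ = ω-induction
    (∀̇∈ v0 (∀̇∈ v2 (⌜IsSuccessor⌝ v1 v0 ⇒̇ v0 ∈̇ v2 ∨̇ v0 ≈̇ v2))) (ω ∷ [])
    (λ m m∈ → ⊥-elim (proj₂ emptySet m m∈))
    (λ n n′ _ S IH m m∈ m′ m′∈ M → step S M (IH m) m′∈ (proj₂ (proj₂ S) m m∈))
    where
    step : ∀ {n n′ m m′} → IsSuccessor n n′ → IsSuccessor m m′ →
           (m ∈ n → ∀ l → l ∈ ω → IsSuccessor m l → l ⊑ n) → m′ ∈ ω → m ⊑ n → m′ ⊑ n′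
    step S M IH m′∈ (inj₁ m∈n) = inj₁ (⊑⇒∈successor (IH m∈n _ m′∈ M) S)
    step S M IH m′∈ (inj₂ e) = inj₂ (IsSuccessor-unique (IsSuccessor-resp e E.refl M) S)

  -- Induction on `n`: if `n ∈ m`, then `∈⇒successor⊑` puts the successor of `n` at or below `m`.
  -- This lets functions on `ω` be defined by cases in intuitionistic logic, as `extended` does.
  ω-trichotomy : ∀ n → n ∈ ω → ∀ m → m ∈ ω → m ⊑ n ⊎ n ∈ m
  ω-trichotomy = ω-induction
    (∀̇∈ v1 ((v0 ∈̇ v1 ∨̇ v0 ≈̇ v1) ∨̇ v1 ∈̇ v0)) (ω ∷ [])
    (λ m m∈ → base (∅⊑ m m∈))
    (λ n n′ n∈ S IH m m∈ → step n∈ S m∈ (IH m m∈))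
    where
    base : ∀ {n m} → n ⊑ m → m ⊑ n ⊎ n ∈ m
    base (inj₁ n∈m) = inj₂ n∈m
    base (inj₂ e) = inj₁ (inj₂ (E.sym e))
    step : ∀ {n n′ m} → n ∈ ω → IsSuccessor n n′ → m ∈ ω → m ⊑ n ⊎ n ∈ m → m ⊑ n′ ⊎ n′ ∈ m
    step n∈ S m∈ (inj₁ m⊑n) = inj₁ (inj₁ (⊑⇒∈successor m⊑n S))
    step n∈ S m∈ (inj₂ n∈m) = base (∈⇒successor⊑ _ m∈ _ n∈m _ (successor∈ω n∈ S) S)

  -- Composition, the identities and the terminal object are parameters because comparing
  -- two composites by unfolding them is very slow.
  module Graphical
    (_∘_ : ∀ {a b c} → Function b c → Function a b → Function a c)
    (∘-intro : ∀ {a b c} (g : Function b c) (f : Function a b) {x y z} →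
               Holds (graph f) x y → Holds (graph g) y z → Holds (graph (g ∘ f)) x z)
    (∘-elim : ∀ {a b c} (g : Function b c) (f : Function a b) {x z} →
              Holds (graph (g ∘ f)) x z → ∃[ y ] Holds (graph f) x y × Holds (graph g) y z)
    (idm : ∀ {a} → Function a a)
    (idm-intro : ∀ {a x} → x ∈ a → Holds (graph (idm {a})) x x)
    (∘-assoc : ∀ {a b c d} (h : Function c d) (g : Function b c) (f : Function a b) →
               (h ∘ g) ∘ f ≐ h ∘ (g ∘ f))
    (∘-identityˡ : ∀ {a b} (f : Function a b) → idm ∘ f ≐ f)
    (∘-identityʳ : ∀ {a b} (f : Function a b) → f ∘ idm ≐ f)
    (∘-resp-≐ : ∀ {a b c} {g g′ : Function b c} {f f′ : Function a b} →
                g ≐ g′ → f ≐ f′ → g ∘ f ≐ g′ ∘ f′)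
    (𝟙 : 𝐕) (∅∈𝟙 : ∅ ∈ 𝟙) (𝟙⊆one : 𝟙 ⊆ one)
    (! : ∀ a → Function a 𝟙) (!-unique : ∀ {a} (f : Function a 𝟙) → f ≐ ! a)
    where

    𝒞 : Category ℓ
    𝒞 = record
      { Obj = 𝐕 ; _⇒_ = Function ; _≈_ = _≐_ ; idm = idm ; _∘_ = _∘_
      ; equiv = record { refl = E.refl ; sym = E.sym ; trans = E.trans }
      ; assoc = ∘-assoc ; identityˡ = ∘-identityˡ ; identityʳ = ∘-identityʳ
      ; ∘-resp-≈ = λ {_} {_} {_} {g} {g′} {f} {f′} → ∘-resp-≐ {g = g} {g′} {f} {f′}
      }

    𝒯 : Terminal 𝒞
    𝒯 = record { 𝟙 = 𝟙 ; ! = ! ; !-unique = !-unique }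

    open Category 𝒞 using (Mono; Iso)

    -- Morphisms and global elements in terms of set elements.

    idm-elim : ∀ {a x y} → Holds (graph (idm {a})) x y → y ≈ x
    idm-elim H = holds-unique idm H (idm-intro (proj₁ (holds-∈ idm H)))

    val : ∀ {a} → Function 𝟙 a → 𝐕
    val u = ap u ∅ ∅∈𝟙

    val-holds : ∀ {a} (u : Function 𝟙 a) → Holds (graph u) ∅ (val u)
    val-holds u = ap-holds u ∅ ∅∈𝟙

    val-∈ : ∀ {a} (u : Function 𝟙 a) → val u ∈ a
    val-∈ u = ap-∈ u ∅ ∅∈𝟙

    abstract
      name : ∀ {a x} → x ∈ a → Function 𝟙 a
      name x∈ = function (constant 𝟙 x∈)

      val-name : ∀ {a x} (x∈ : x ∈ a) → val (name x∈) ≈ x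
      val-name x∈ = proj₂ (proj₂ (to (spec (constant 𝟙 x∈) _ _) (val-holds (name x∈))))

    val-cong : ∀ {a} (u v : Function 𝟙 a) → u ≐ v → val u ≈ val v
    val-cong u v e = holds-unique v (≐-elim {f = u} {v} e (val-holds u)) (val-holds v)

    -- As `∅` is the only element of `𝟙`, a global element is determined by its value there.
    val-injective : ∀ {a} (u v : Function 𝟙 a) → val u ≈ val v → u ≐ v
    val-injective u v e = ≐-intro u v λ x y H →
      let x≈∅ = ∈one⇒≈∅ (𝟙⊆one x (proj₁ (holds-∈ u H)))
          y≈u = holds-unique u (Holds-resp E.refl x≈∅ E.refl H) (val-holds u)
      in Holds-resp E.refl (E.sym x≈∅) (E.sym (E.trans y≈u e)) (val-holds v)

    val-∘ : ∀ {a b} (f : Function a b) (u : Function 𝟙 a) →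
            Holds (graph f) (val u) (val (f ∘ u))
    val-∘ f u =
      let y , U , F = ∘-elim f u (val-holds (f ∘ u))
      in Holds-resp E.refl (holds-unique u U (val-holds u)) E.refl F

    val-∘-≈ : ∀ {a b x y} (f : Function a b) (u : Function 𝟙 a) →
              Holds (graph f) x y → val u ≈ x → val (f ∘ u) ≈ y
    val-∘-≈ f u H e = holds-unique f (val-∘ f u) (Holds-resp E.refl (E.sym e) E.refl H)

    ∘≐-elim : ∀ {a b} (f : Function a b) (e : Function 𝟙 a) (u : Function 𝟙 b) →
              f ∘ e ≐ u → Holds (graph f) (val e) (val u)
    ∘≐-elim f e u p = Holds-resp E.refl E.refl (val-cong (f ∘ e) u p) (val-∘ f e)

    ∘≐-intro : ∀ {a b x} (f : Function a b) (e : Function 𝟙 a) (u : Function 𝟙 b) →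
               val e ≈ x → Holds (graph f) x (val u) → f ∘ e ≐ u
    ∘≐-intro f e u p H = val-injective (f ∘ e) u (val-∘-≈ f e H p)

    injective⇒Mono : ∀ {a b} (f : Function a b) → Injective f → Mono f
    injective⇒Mono f inj u v e = ≐-intro u v λ z x U →
      let F = ap-holds f x (proj₂ (holds-∈ u U))
          x′ , U′ , F′ = ∘-elim f v (≐-elim {f = f ∘ u} {f ∘ v} e (∘-intro f u U F))
      in Holds-resp E.refl E.refl (inj x′ x _ F′ F) U′

    -- Monicity is tested on global elements: two elements with the same image are named by two maps
    -- out of `𝟙` that become equal after `f`.
    Mono⇒injective : ∀ {a b} (f : Function a b) → Mono f → Injective f
    Mono⇒injective f mono x x′ y F F′ =
      let x∈ = proj₁ (holds-∈ f F)
          x′∈ = proj₁ (holds-∈ f F′)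
          e = mono (name x∈) (name x′∈) (val-injective (f ∘ name x∈) (f ∘ name x′∈)
                (E.trans (val-∘-≈ f (name x∈) F (val-name x∈))
                  (E.sym (val-∘-≈ f (name x′∈) F′ (val-name x′∈)))))
      in E.trans (E.sym (val-name x∈))
           (E.trans (val-cong (name x∈) (name x′∈) e) (val-name x′∈))

    leftInverse⇒injective : ∀ {a b} (f : Function a b) (g : Function b a) →
                            g ∘ f ≐ idm → Injective f
    leftInverse⇒injective f g e x x′ y F F′ =
      let G = ap-holds g y (proj₂ (holds-∈ f F))
          e₁ = idm-elim (≐-elim {f = g ∘ f} {idm} e (∘-intro g f F G))
          e₂ = idm-elim (≐-elim {f = g ∘ f} {idm} e (∘-intro g f F′ G))
      in E.trans (E.sym e₁) e₂

    rightInverse⇒surjective : ∀ {a b} (f : Function a b) (g : Function b a) →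
                              f ∘ g ≐ idm → Surjective f
    rightInverse⇒surjective f g e y y∈ =
      let x , G , F = ∘-elim f g (≐-elim {f = idm} {f ∘ g} (E.sym e) (idm-intro y∈))
      in x , F

    bijective⇒Iso : ∀ {a b} (f : Function a b) → Injective f → Surjective f → Iso f
    bijective⇒Iso f inj sur = f⁻¹ ,
        ≐-intro (f⁻¹ ∘ f) idm (λ x z H →
          let y , F , G = ∘-elim f⁻¹ f H
              _ , _ , F′ = to (spec (inverse f inj sur) y z) G
          in Holds-resp E.refl E.refl (inj x z y F F′) (idm-intro (proj₁ (holds-∈ f F)))) ,
        ≐-intro (f ∘ f⁻¹) idm (λ y z H →
          let x , G , F = ∘-elim f f⁻¹ H
              y∈ , _ , F′ = to (spec (inverse f inj sur) y x) G
          in Holds-resp E.refl E.refl (holds-unique f F′ F) (idm-intro y∈))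
      where
      f⁻¹ = function (inverse f inj sur)

    -- Besides its universal property, the natural numbers object is known through its elements: `N`
    -- has those of `ω`, `z` names `∅` and `s` is the successor.
    module Realisation (𝒩 : NNO 𝒞 𝒯)
      (N⊆ω : NNO.N 𝒩 ⊆ ω) (ω⊆N : ω ⊆ NNO.N 𝒩)
      (z-elim : ∀ {y} → Holds (graph (NNO.z 𝒩)) ∅ y → y ≈ ∅)
      (s-intro : ∀ {x y} → x ∈ ω → IsSuccessor x y → Holds (graph (NNO.s 𝒩)) x y)
      (s-elim : ∀ {x y} → Holds (graph (NNO.s 𝒩)) x y → IsSuccessor x y)
      where

      open NNO 𝒩
      open Graphs 𝒞 𝒯 𝒩
      open Canonical V 𝒞 𝒯 𝒩 id val

      -- Graphs as relations on sets.

      ∈ₘ⇔ : ∀ G {s} (m : Function s (Graph.X G)) (u : Graph.Node G) →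
            u ∈ₘ m ⇔ (∃[ z ] z ∈ s × Holds (graph m) z (val u))
      ∈ₘ⇔ G m u = mk⇔
        (λ where (w , e) → val w , val-∈ w , ∘≐-elim m w u e)
        (λ where (z , z∈ , H) → name z∈ , ∘≐-intro m (name z∈) u (val-name z∈) H)

      ≺⇔ : ∀ G u v → Graph._≺_ G u v ⇔
           (∃[ e ] e ∈ Graph.R G × Holds (graph (Graph.source G)) e (val u) ×
                                   Holds (graph (Graph.target G)) e (val v))
      ≺⇔ G u v = mk⇔
        (λ where (e , p , q) → val e , val-∈ e ,
                                 ∘≐-elim source e u p , ∘≐-elim target e v q)
        (λ where (e , e∈ , S , T) →
                   name e∈ , ∘≐-intro source (name e∈) u (val-name e∈) S ,
                   ∘≐-intro target (name e∈) v (val-name e∈) T)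
        where open Graph G

      -- `≺` quantifies over global elements and is not literally a Δ₀-formula; a set of ordered
      -- pairs with the same content can be a parameter of separation and induction.
      Represents : Graph → 𝐕 → Set ℓ
      Represents G r = ∀ u v → Graph._≺_ G u v ⇔ Holds r (val u) (val v)

      -- The set of pairs `r` is itself the object of edges, with the two projections as source and
      -- target. They are jointly monic because a pair is determined by its components.
      module RelationGraph {a r : 𝐕} (R : IsRelation r a a) where

        private
          sources : Definable r a (λ p x → ∃[ y ] y ∈ a × IsPair p x y)
          sources = define r a [] (∃̇∈ v3 (⌜IsPair⌝ v2 v1 v0)) _
            (λ _ _ _ → mk⇔ id id)
            (λ p p∈ → R p p∈)
            (λ where _ _ _ _ _ _ (_ , _ , P) (_ , _ , Q) → proj₁ (IsPair-injective P Q))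

          targets : Definable r a (λ p y → ∃[ x ] x ∈ a × IsPair p x y)
          targets = define r a [] (∃̇∈ v3 (⌜IsPair⌝ v2 v0 v1)) _
            (λ _ _ _ → mk⇔ id id)
            (λ p p∈ → let x , x∈ , y , y∈ , P = R p p∈ in y , y∈ , x , x∈ , P)
            (λ where _ _ _ _ _ _ (_ , _ , P) (_ , _ , Q) → proj₂ (IsPair-injective P Q))

          src : Function r a
          src = function sources

          tgt : Function r a
          tgt = function targets

          src-intro : ∀ {p x y} → p ∈ r → x ∈ a → y ∈ a → IsPair p x y → Holds (graph src) p x
          src-intro p∈ x∈ y∈ P = from (spec sources _ _) (p∈ , x∈ , _ , y∈ , P)

          tgt-intro : ∀ {p x y} → p ∈ r → x ∈ a → y ∈ a → IsPair p x y → Holds (graph tgt) p y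
          tgt-intro p∈ x∈ y∈ P = from (spec targets _ _) (p∈ , y∈ , _ , x∈ , P)

          src-tgt-elim : ∀ {p x y} → Holds (graph src) p x → Holds (graph tgt) p y → IsPair p x y
          src-tgt-elim S T =
            let _ , _ , _ , _ , P = to (spec sources _ _) S
                _ , _ , _ , _ , Q = to (spec targets _ _) T
            in IsPair-resp E.refl E.refl (proj₂ (IsPair-injective P Q)) P

        relationGraph : Graph
        relationGraph = record
          { X = a ; R = r ; source = src ; target = tgt
          ; jointly-monic = λ u v e e′ → ≐-intro u v λ z p U →
              let p∈ = proj₂ (holds-∈ u U)
                  x , x∈ , y , y∈ , P = R p p∈
                  q , Q , S = ∘-elim src v (≐-elim {f = src ∘ u} {src ∘ v} e
                                (∘-intro src u U (src-intro p∈ x∈ y∈ P)))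
                  q′ , Q′ , T = ∘-elim tgt v (≐-elim {f = tgt ∘ u} {tgt ∘ v} e′
                                  (∘-intro tgt u U (tgt-intro p∈ x∈ y∈ P)))
                  P′ = src-tgt-elim S (Holds-resp E.refl (holds-unique v Q′ Q) E.refl T)
              in Holds-resp E.refl E.refl (IsPair-unique P′ P) Q
          }

        represents : Represents relationGraph r
        represents u v = mk⇔
          (λ ≺ → let p , p∈ , S , T = to (≺⇔ relationGraph u v) ≺ in p , p∈ , src-tgt-elim S T)
          (λ where (p , p∈ , P) → from (≺⇔ relationGraph u v)
                     (p , p∈ , src-intro p∈ (val-∈ u) (val-∈ v) P ,
                               tgt-intro p∈ (val-∈ u) (val-∈ v) P))

      open RelationGraph

      -- Edges of an arbitrary graph need not be ordered pairs; `r` collects the pairs of their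
      -- sources and targets.
      edges : ∀ G → ∃[ r ] IsRelation r (Graph.X G) (Graph.X G) × Represents G r
      edges G =
        let r , isR , S = relation X X (R ∷ graph source ∷ graph target ∷ [])
                            (∃̇∈ v5 (⌜Holds⌝ v7 v0 v2 ∧̇ ⌜Holds⌝ v8 v0 v1)) _
                            (λ _ _ _ → mk⇔ id id)
        in r , isR , λ u v → mk⇔
          (λ p → from (S _ _) (val-∈ u , val-∈ v , to (≺⇔ G u v) p))
          (λ H → from (≺⇔ G u v) (proj₂ (proj₂ (to (S _ _) H))))
        where open Graph G

      module Represented {G : Graph} {r : 𝐕} (rep : Represents G r) where
        open Graph G

        ≺⇒Holds : ∀ u v {x y} → val u ≈ x → val v ≈ y → u ≺ v → Holds r x y
        ≺⇒Holds u v e e′ p = Holds-resp E.refl e e′ (to (rep u v) p)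

        Holds⇒≺ : ∀ u v {x y} → val u ≈ x → val v ≈ y → Holds r x y → u ≺ v
        Holds⇒≺ u v e e′ H = from (rep u v) (Holds-resp E.refl (E.sym e) (E.sym e′) H)

        -- A monic `m` is replaced by its image, a subset of `X` to which well-foundedness of `r`
        -- applies. Once the image is `X`, `m` is a bijection.
        wellFounded⇒ : IsWellFoundedRelation X r → IsWellFounded
        wellFounded⇒ wf {S} m mono ind = bijective⇒Iso m (Mono⇒injective m mono) λ y y∈ →
            let _ , z , _ , H = to (I y) (∈-respʳ (E.sym image≈X) y∈) in z , H
          where
          image : ∃[ i ] (∀ x → x ∈ i ⇔ (x ∈ X × (∃[ z ] z ∈ S × Holds (graph m) z x)))
          image = separation (∃̇∈ v1 (⌜Holds⌝ v3 v0 v1)) (S ∷ graph m ∷ []) X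
          I = proj₂ image
          image≈X : proj₁ image ≈ X
          image≈X = wf (proj₁ image) (λ x x∈ → proj₁ (to (I x) x∈)) λ x x∈ h →
            let z , z∈ , H = to (∈ₘ⇔ G m (name x∈)) (ind (name x∈) λ w w≺x →
                  from (∈ₘ⇔ G m w) (proj₂ (to (I (val w))
                    (h (val w) (≺⇒Holds w (name x∈) E.refl (val-name x∈) w≺x)))))
            in from (I x) (x∈ , z , z∈ , Holds-resp E.refl E.refl (val-name x∈) H)

        -- A subset is tested through its inclusion, which is monic; when the inclusion is an
        -- isomorphism it is surjective, so the subset is everything.
        wellFounded⇐ : IsRelation r X X → IsWellFounded → IsWellFoundedRelation X r
        wellFounded⇐ isR wf s s⊆X ind = extensionality s X λ x → mk⇔ (s⊆X x) λ x∈ →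
            let z , H = rightInverse⇒surjective m (proj₁ iso) (proj₂ (proj₂ iso)) x x∈
            in ∈-respˡ (E.sym (include-elim s⊆X H)) (proj₁ (holds-∈ m H))
          where
          m : Function s X
          m = include s⊆X
          iso : Iso m
          iso = wf m (injective⇒Mono m (include-injective s⊆X)) λ u h →
            let u∈ = ind (val u) (val-∈ u) λ y H →
                  let y∈ = proj₁ (relation-∈ isR H)
                      z , z∈ , M = to (∈ₘ⇔ G m (name y∈))
                        (h (name y∈) (Holds⇒≺ (name y∈) u (val-name y∈) E.refl H))
                  in ∈-respˡ (E.trans (E.sym (include-elim s⊆X M)) (val-name y∈)) z∈
            in from (∈ₘ⇔ G m u) (val u , u∈ , include-intro s⊆X u∈)

        -- As `r` relates only elements of `X`, every predecessor is named by a node, so agreement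
        -- on nodes is agreement on all sets.
        extensional⇒ : IsRelation r X X → IsExtensionalRelation X r → IsExtensional
        extensional⇒ isR ext u v h = val-injective u v
            (ext (val u) (val v) (val-∈ u) (val-∈ v) λ z →
              mk⇔ (half u v (λ w → to (h w))) (half v u (λ w → from (h w))))
          where
          half : ∀ u v → (∀ w → w ≺ u → w ≺ v) → ∀ {z} → Holds r z (val u) → Holds r z (val v)
          half u v h H =
            let z∈ = proj₁ (relation-∈ isR H)
            in ≺⇒Holds (name z∈) v (val-name z∈) E.refl
                 (h (name z∈) (Holds⇒≺ (name z∈) u (val-name z∈) E.refl H))

        extensional⇐ : IsExtensional → IsExtensionalRelation X r
        extensional⇐ ext x y x∈ y∈ h =
          E.trans (E.sym (val-name x∈))
            (E.trans (val-cong (name x∈) (name y∈) (ext (name x∈) (name y∈) λ w → mk⇔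
                (λ p → Holds⇒≺ w (name y∈) E.refl (val-name y∈)
                  (to (h (val w)) (≺⇒Holds w (name x∈) E.refl (val-name x∈) p)))
                (λ p → Holds⇒≺ w (name x∈) E.refl (val-name x∈)
                  (from (h (val w)) (≺⇒Holds w (name y∈) E.refl (val-name y∈) p)))))
              (val-name y∈))

      -- The order on the natural numbers object.

      iter-increases : ∀ k j → j ∈ ω → ∀ y → y ∈ N → Holds (graph (iter k s)) j y → j ⊑ y
      iter-increases k = ω-induction
        (∀̇∈ v1 (⌜Holds⌝ v3 v1 v0 ⇒̇ v1 ∈̇ v0 ∨̇ v1 ≈̇ v0)) (N ∷ graph f ∷ [])
        (λ y y∈ _ → ∅⊑ y (N⊆ω y y∈))
        (λ j j′ j∈ S IH y′ y′∈ H →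
          let y∈ = ap-∈ f j (ω⊆N j j∈)
              F = ap-holds f j (ω⊆N j j∈)
              n , F′ , G = ∘-elim s f (≐-elim {f = f ∘ s} {s ∘ f} (iter-s k s)
                             (∘-intro f s (s-intro j∈ S) H))
          in step (N⊆ω _ y∈) (successor∈ω j∈ S) S
               (IsSuccessor-resp (holds-unique f F′ F) E.refl (s-elim G)) (IH _ y∈ F))
        where
        f : Function N N
        f = iter k s
        step : ∀ {j j′ y y′} → y ∈ ω → j′ ∈ ω → IsSuccessor j j′ → IsSuccessor y y′ →
               j ⊑ y → j′ ⊑ y′
        step y∈ j′∈ S T (inj₁ j∈y) = inj₁ (⊑⇒∈successor (∈⇒successor⊑ _ y∈ _ j∈y _ j′∈ S) T)
        step y∈ j′∈ S T (inj₂ e) = inj₂ (IsSuccessor-unique (IsSuccessor-resp e E.refl S) T)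

      -- `iter k s` is addition to `k`, so `m ∈ m + 1 ⊑ k + (m + 1) = n`, where `iter-increases`
      -- gives the middle step.
      <⇒∈ : (m n : Function 𝟙 N) → m < n → val m ∈ val n
      <⇒∈ m n (k , e) =
        ∈-⊑-trans (N⊆ω _ (val-∈ n)) (proj₁ (proj₂ (s-elim (val-∘ s m))))
          (iter-increases k (val (s ∘ m)) (N⊆ω _ (val-∈ (s ∘ m))) (val n) (val-∈ n)
            (∘≐-elim (iter k s) (s ∘ m) n e))

      private
        -- Functions commuting with the successor are the translations `x ↦ f(∅) + x`. Bounding the
        -- witnesses by `ω` makes the condition Δ₀.
        Commutes : 𝐕 → Set ℓ
        Commutes f = ∀ x → x ∈ ω → ∀ x′ → x′ ∈ ω → IsSuccessor x x′ →
          ∃[ y ] y ∈ ω × (∃[ y′ ] y′ ∈ ω × Holds f x y × Holds f x′ y′ × IsSuccessor y y′)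

        N^N : 𝐕
        N^N = proj₁ (exponentials N N)

        fun : ∀ {f} → f ∈ N^N → Function N N
        fun {f} f∈ = mkFunction f (to (proj₂ (exponentials N N) f) f∈)

        Translation : 𝐕 → 𝐕 → Set ℓ
        Translation m n =
          ∃[ f ] f ∈ N^N × Commutes f × (∃[ m′ ] m′ ∈ ω × IsSuccessor m m′ × Holds f m′ n)

        translate : (g : Function N N) → Commutes (graph g) → ∀ {m m′ n} →
                    m′ ∈ ω → IsSuccessor m m′ → Holds (graph g) m′ n → Translation m n
        translate g C m′∈ M H =
          graph g , from (proj₂ (exponentials N N) (graph g)) (isFunction g) , C , _ , m′∈ , M , H

        Commutes-id : Commutes (graph (idm {N}))
        Commutes-id x x∈ x′ x′∈ X =
          x , x∈ , x′ , x′∈ , idm-intro (ω⊆N x x∈) , idm-intro (ω⊆N x′ x′∈) , X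

        Commutes-s : (g : Function N N) → Commutes (graph g) → Commutes (graph (s ∘ g))
        Commutes-s g C x x∈ x′ x′∈ X =
          let y , y∈ , y′ , y′∈ , F , F′ , Y = C x x∈ x′ x′∈ X
              y″ , Y′ = successor y′
          in y′ , y′∈ , y″ , successor∈ω y′∈ Y′ ,
             ∘-intro s g F (s-intro y∈ Y) , ∘-intro s g F′ (s-intro y′∈ Y′) , Y′

        -- Uniqueness of iteration: `g` solves the recursion that starts at `g ∘ z` and repeats `s`.
        Commutes⇒iter : (g : Function N N) → Commutes (graph g) → g ≐ iter (g ∘ z) s
        Commutes⇒iter g C = iter-uniq (g ∘ z) s g E.refl
          (≐-intro (g ∘ s) (s ∘ g) λ x y′ H →
            let x′ , X , G = ∘-elim g s H
                x∈ , x′∈ = holds-∈ s X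
                y , y∈ , y″ , y″∈ , F , F′ , Y = C x (N⊆ω x x∈) x′ (N⊆ω x′ x′∈) (s-elim X)
            in ∘-intro s g F (s-intro y∈ (IsSuccessor-resp E.refl (holds-unique g F′ G) Y)))

        -- This produces the difference of `n` and `m + 1` in the form of a translation. Going from
        -- `n` to its successor, a translation for `m ∈ n` is followed by `s`, and the new case
        -- `m ≈ n` is served by the identity.
        translation : ∀ n → n ∈ ω → ∀ m → m ∈ n → Translation m n
        translation = ω-induction
          (∀̇∈ v0 (∃̇∈ v3
            (∀̇∈ v3 (∀̇∈ v4 (⌜IsSuccessor⌝ v1 v0 ⇒̇
               ∃̇∈ v5 (∃̇∈ v6 (⌜Holds⌝ v4 v3 v1 ∧̇ ⌜Holds⌝ v4 v2 v0 ∧̇ ⌜IsSuccessor⌝ v1 v0)))) ∧̇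
             ∃̇∈ v3 (⌜IsSuccessor⌝ v2 v0 ∧̇ ⌜Holds⌝ v1 v0 v3))))
          (ω ∷ N^N ∷ [])
          (λ m m∈ → ⊥-elim (proj₂ emptySet m m∈))
          (λ n n′ n∈ S IH m m∈ → step n∈ S (IH m) (proj₂ (proj₂ S) m m∈))
          where
          step : ∀ {n n′ m} → n ∈ ω → IsSuccessor n n′ →
                 (m ∈ n → Translation m n) → m ⊑ n → Translation m n′
          step n∈ S IH (inj₁ m∈n) =
            let f , f∈ , C , m′ , m′∈ , M , H = IH m∈n
            in translate (s ∘ fun f∈) (Commutes-s (fun f∈) C) m′∈ M
                 (∘-intro s (fun f∈) H (s-intro n∈ S))
          step n∈ S IH (inj₂ e) =
            let n′∈ = successor∈ω n∈ S
            in translate idm Commutes-id n′∈ (IsSuccessor-resp (E.sym e) E.refl S)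
                 (idm-intro (ω⊆N _ n′∈))

      ∈⇒< : (m n : Function 𝟙 N) → val m ∈ val n → m < n
      ∈⇒< m n m∈n =
        let f , f∈ , C , m′ , m′∈ , M , F = translation (val n) (N⊆ω _ (val-∈ n)) (val m) m∈n
            g = fun f∈
        -- The number `k` with `k + (m + 1) = n` is the value of the translation at zero.
        in g ∘ z , ∘≐-intro (iter (g ∘ z) s) (s ∘ m) n
                     (val-∘-≈ s m (s-intro (N⊆ω _ (val-∈ m)) M) E.refl)
                     (≐-elim {f = g} {iter (g ∘ z) s} (Commutes⇒iter g C) F)

      -- Paths as a Δ₀ notion.

      Reaches : 𝐕 → 𝐕 → 𝐕 → 𝐕 → Set ℓ
      Reaches a r u y = ∃[ n ] n ∈ ω × (∃[ p ] p ∈ proj₁ (exponentials N a) ×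
        Holds p n u × Holds p ∅ y ×
        (∀ m → m ∈ n → ∀ m′ → m′ ∈ ω → IsSuccessor m m′ →
          ∃[ v ] v ∈ a × (∃[ w ] w ∈ a × Holds p m′ v × Holds p m w × Holds r v w)))

      -- The path is drawn from an exponential and its indices from `ω`, so every quantifier of
      -- `Reaches` is bounded and separation applies.
      reachable : ∀ a r y → ∃[ s ] (∀ u → u ∈ s ⇔ (u ∈ a × Reaches a r u y))
      reachable a r y = separation
        (∃̇∈ v1 (∃̇∈ v3 (⌜Holds⌝ v0 v1 v2 ∧̇ ⌜Holds⌝ v0 v5 v6 ∧̇
          ∀̇∈ v1 (∀̇∈ v4 (⌜IsSuccessor⌝ v1 v0 ⇒̇
            ∃̇∈ v9 (∃̇∈ (suc v9)
              (⌜Holds⌝ v4 v2 v1 ∧̇ ⌜Holds⌝ v4 v3 v0 ∧̇ ⌜Holds⌝ (suc (suc (suc v9))) v1 v0)))))))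
        (ω ∷ proj₁ (exponentials N a) ∷ ∅ ∷ y ∷ a ∷ r ∷ []) a

      module Reaching {a r : 𝐕} where

        path : ∀ {p} → p ∈ proj₁ (exponentials N a) → Function N a
        path {p} p∈ = mkFunction p (to (proj₂ (exponentials N a) p) p∈)

        path-∈ : (p : Function N a) → graph p ∈ proj₁ (exponentials N a)
        path-∈ p = from (proj₂ (exponentials N a) (graph p)) (isFunction p)

        Reaches-refl : ∀ {x} → x ∈ a → Reaches a r x x
        Reaches-refl x∈ =
          let p = constant N x∈
              H = from (spec p _ _) (ω⊆N _ ∅∈ω , x∈ , E.refl)
          in ∅ , ∅∈ω , graph (function p) , path-∈ (function p) , H , H ,
             λ m m∈ → ⊥-elim (proj₂ emptySet m m∈)

        -- A path is a total function on `N`. The new vertex `w` goes at index `n`, and repeating it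
        -- beyond `n` is mere padding.
        Extended : 𝐕 → 𝐕 → 𝐕 → 𝐕 → 𝐕 → Set ℓ
        Extended p n w m x = (m ∈ n × Holds p m x) ⊎ ((m ≈ n ⊎ n ∈ m) × x ≈ w)

        extended : (p : Function N a) → ∀ {n w} → n ∈ ω → w ∈ a →
                   Definable N a (Extended (graph p) n w)
        extended p {n} {w} n∈ w∈ = define N a (n ∷ graph p ∷ w ∷ [])
          ((v1 ∈̇ v5 ∧̇ ⌜Holds⌝ v6 v1 v0) ∨̇ ((v1 ≈̇ v5 ∨̇ v5 ∈̇ v1) ∧̇ v0 ≈̇ v7)) _
          (λ _ _ _ → mk⇔ id id)
          (λ m m∈ → total m∈ (ω-trichotomy n n∈ m (N⊆ω m m∈)))
          (λ _ _ _ _ _ _ → functional)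
          where
          total : ∀ {m} → m ∈ N → m ⊑ n ⊎ n ∈ m → ∃[ x ] x ∈ a × Extended (graph p) n w m x
          total m∈ (inj₁ (inj₁ m∈n)) = ap p _ m∈ , ap-∈ p _ m∈ , inj₁ (m∈n , ap-holds p _ m∈)
          total m∈ (inj₁ (inj₂ e)) = w , w∈ , inj₂ (inj₁ e , E.refl)
          total m∈ (inj₂ n∈m) = w , w∈ , inj₂ (inj₂ n∈m , E.refl)
          disjoint : ∀ {m} {A : Set ℓ} → m ∈ n → m ≈ n ⊎ n ∈ m → A
          disjoint m∈n (inj₁ e) = Polymorphic.⊥-elim (ω-irreflexive n n∈ (∈-respˡ e m∈n))
          disjoint m∈n (inj₂ n∈m) =
            Polymorphic.⊥-elim (ω-irreflexive n n∈ (ω-transitive n n∈ _ _ n∈m m∈n))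
          functional : ∀ {m x x′} → Extended (graph p) n w m x → Extended (graph p) n w m x′ → x ≈ x′
          functional (inj₁ (_ , H)) (inj₁ (_ , H′)) = holds-unique p H H′
          functional (inj₁ (m∈n , _)) (inj₂ (c , _)) = disjoint m∈n c
          functional (inj₂ (c , _)) (inj₁ (m∈n , _)) = disjoint m∈n c
          functional (inj₂ (_ , e)) (inj₂ (_ , e′)) = E.trans e (E.sym e′)

        -- Paths are indexed from their end `y` at `∅` up to their start at `n`, so a new start is
        -- added at index `n + 1` and no index shifts.
        Reaches-extend : ∀ {u w y} → w ∈ a → Holds r w u → Reaches a r u y → Reaches a r w y
        Reaches-extend {u} {w} {y} w∈ R (n , n∈ , p , p∈ , U , Y , step) =
          n′ , n′∈ , graph q , path-∈ q ,
          keep {n′} (ω⊆N _ n′∈) w∈ (inj₂ (inj₁ E.refl , E.refl)) ,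
          keep (ω⊆N _ ∅∈ω) (proj₂ (holds-∈ (path p∈) Y))
            (inj₁ (⊑⇒∈successor (∅⊑ n n∈) N′ , Y)) ,
          λ m m∈ m′ m′∈ M → extend m∈ m′∈ M (proj₂ (proj₂ N′) m m∈)
          where
          n′ : 𝐕
          n′ = proj₁ (successor n)
          N′ : IsSuccessor n n′
          N′ = proj₂ (successor n)
          n′∈ : n′ ∈ ω
          n′∈ = successor∈ω n∈ N′
          -- The cut is at `n′`, not `n`: index `n` keeps its old vertex `u`, and the new edge joins
          -- `n′` to `n`.
          Q : Definable N a (Extended p n′ w)
          Q = extended (path p∈) n′∈ w∈
          q : Function N a
          q = function Q
          keep : ∀ {m x} → m ∈ N → x ∈ a → Extended p n′ w m x → Holds (graph q) m x
          keep m∈ x∈ h = from (spec Q _ _) (m∈ , x∈ , h)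
          extend : ∀ {m m′} → m ∈ n′ → m′ ∈ ω → IsSuccessor m m′ → m ⊑ n →
            ∃[ v ] v ∈ a × (∃[ x ] x ∈ a ×
              Holds (graph q) m′ v × Holds (graph q) m x × Holds r v x)
          extend {m} {m′} m∈ m′∈ M (inj₁ m∈n) =
            let v , v∈ , x , x∈ , P , P′ , R′ = step m m∈n m′ m′∈ M
                m′∈n′ = ⊑⇒∈successor (∈⇒successor⊑ n n∈ m m∈n m′ m′∈ M) N′
            in v , v∈ , x , x∈ , keep (ω⊆N _ m′∈) v∈ (inj₁ (m′∈n′ , P)) ,
               keep (proj₁ (holds-∈ (path p∈) P′)) x∈ (inj₁ (m∈ , P′)) , R′
          extend {m} {m′} m∈ m′∈ M (inj₂ e) =
            let u∈ = proj₂ (holds-∈ (path p∈) U) in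
            w , w∈ , u , u∈ ,
            keep (ω⊆N _ m′∈) w∈ (inj₂ (inj₁ (IsSuccessor-unique (IsSuccessor-resp e E.refl M) N′) , E.refl)) ,
            keep (ω⊆N _ (ω-members n′ n′∈ m m∈)) u∈
              (inj₁ (m∈ , Holds-resp E.refl (E.sym e) E.refl U)) , R

        -- Induction on the index along the path, from `y ∈ s` at `∅` up to `u` at `n`; each edge
        -- carries membership in `s` to its source.
        Reaches-closed : ∀ {u y s} → Reaches a r u y → y ∈ s →
          (∀ v w → Holds r v w → w ∈ s → v ∈ s) → u ∈ s
        Reaches-closed {u} {y} {s} (n , n∈ , p , p∈ , U , Y , step) y∈s closed =
          let x , x∈s , P = along n n∈ (inj₂ E.refl)
          in ∈-respˡ (holds-unique (path p∈) P U) x∈s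
          where
          along : ∀ m → m ∈ ω → m ⊑ n → ∃[ x ] x ∈ s × Holds p m x
          along = ω-induction (v0 ∈̇ v1 ∨̇ v0 ≈̇ v1 ⇒̇ ∃̇∈ v2 (⌜Holds⌝ v4 v1 v0))
            (n ∷ s ∷ p ∷ [])
            (λ _ → y , y∈s , Y)
            (λ m m′ m∈ M IH c →
              let m∈n = ∈-⊑-trans n∈ (proj₁ (proj₂ M)) c
                  v , _ , w , _ , P , P′ , R = step m m∈n m′ (successor∈ω m∈ M) M
                  x , x∈s , P″ = IH (inj₁ m∈n)
              in v , closed v w R (∈-respˡ (holds-unique (path p∈) P″ P′) x∈s) , P)

      module RepresentedPaths (G : Graph) {r : 𝐕} (isR : IsRelation r (Graph.X G) (Graph.X G))
        (rep : Represents G r) where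

        open Graph G
        open Represented {G} rep
        open Reaching {X} {r}

        -- A path has a step for each global element of `N` below `n`, while `Reaches` has one for
        -- each member of `val n`. The two agree by `∈⇒<` here and by `<⇒∈` in the converse.
        Path⇒Reaches : ∀ u v → Path u v → Reaches X r (val u) (val v)
        Path⇒Reaches u v (n , p , pn , pz , step) =
          val n , N⊆ω _ (val-∈ n) , graph p , path-∈ p , ∘≐-elim p n u pn ,
          Holds-resp E.refl (z-elim (val-holds z)) E.refl (∘≐-elim p z v pz) ,
          λ m m∈ m′ m′∈ M →
            let m∈ω = ω-members _ (N⊆ω _ (val-∈ n)) m m∈
                k = name (ω⊆N m m∈ω)
                e = val-name (ω⊆N m m∈ω)
                S = val-∘-≈ s k (s-intro m∈ω M) e
            in val (p ∘ (s ∘ k)) , val-∈ (p ∘ (s ∘ k)) , val (p ∘ k) , val-∈ (p ∘ k) ,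
               Holds-resp E.refl S E.refl (val-∘ p (s ∘ k)) ,
               Holds-resp E.refl e E.refl (val-∘ p k) ,
               ≺⇒Holds (p ∘ (s ∘ k)) (p ∘ k) E.refl E.refl
                 (step k (∈⇒< k n (∈-respˡ (E.sym e) m∈)))

        Reaches⇒Path : ∀ u v → Reaches X r (val u) (val v) → Path u v
        Reaches⇒Path u v (n , n∈ , p , p∈ , U , Y , step) =
          k , q , ∘≐-intro q k u e U , ∘≐-intro q z v (z-elim (val-holds z)) Y ,
          λ m m<k →
            let M = s-elim (val-∘ s m)
                v , v∈ , w , w∈ , P , P′ , R =
                  step (val m) (∈-respʳ e (<⇒∈ m k m<k)) (val (s ∘ m)) (N⊆ω _ (val-∈ (s ∘ m))) M
            in Holds⇒≺ (q ∘ (s ∘ m)) (q ∘ m)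
                 (val-∘-≈ q (s ∘ m) P E.refl) (val-∘-≈ q m P′ E.refl) R
          where
          k = name (ω⊆N n n∈)
          e = val-name (ω⊆N n n∈)
          q = path p∈

        Path-extend : ∀ w u v → w ≺ u → Path u v → Path w v
        Path-extend w u v w≺u P = Reaches⇒Path w v
          (Reaches-extend (val-∈ w) (≺⇒Holds w u E.refl E.refl w≺u) (Path⇒Reaches u v P))

        Path-closed : ∀ u v {s} → Path u v → val v ∈ s →
          (∀ v w → Holds r v w → w ∈ s → v ∈ s) → val u ∈ s
        Path-closed u v P = Reaches-closed (Path⇒Reaches u v P)

      Path-extend : ∀ G w u v → Graph._≺_ G w u → Graph.Path G u v → Graph.Path G w v
      Path-extend G =
        let r , isR , rep = edges G in RepresentedPaths.Path-extend G isR rep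

      -- Graphs and isomorphisms from set-theoretic data.

      ≅-intro : (G H : PointedGraph) (h : Function (PointedGraph.X G) (PointedGraph.X H)) →
        Injective h → Surjective h →
        (∀ u v → PointedGraph._≺_ G u v ⇔ PointedGraph._≺_ H (h ∘ u) (h ∘ v)) →
        Holds (graph h) (val (PointedGraph.⋆ G)) (val (PointedGraph.⋆ H)) → G ≅ H
      ≅-intro G H h inj sur h-≺ h-⋆ =
        let h⁻¹ , e , e′ = bijective⇒Iso h inj sur in record
        { fwd = h ; bwd = h⁻¹ ; bwd∘fwd = e ; fwd∘bwd = e′ ; fwd-≺ = h-≺
        ; fwd-⋆ = ∘≐-intro h (PointedGraph.⋆ G) (PointedGraph.⋆ H) E.refl h-⋆ }

      wfExtAPG : ∀ {a r y} → IsRelation r a a → IsWellFoundedRelation a r →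
        IsExtensionalRelation a r → y ∈ a → (∀ x → x ∈ a → Reaches a r x y) → WFExtAPG
      wfExtAPG {a} {r} {y} isR wf ext y∈ reaches = record
        { pointedGraph = record { graph = G ; ⋆ = name y∈ }
        ; accessible = λ u → RepresentedPaths.Reaches⇒Path G isR rep u (name y∈)
            (Reaches-resp (E.sym (val-name y∈)) (reaches (val u) (val-∈ u)))
        ; wellFounded = λ {S} → Represented.wellFounded⇒ {G} rep wf {S}
        ; extensional = Represented.extensional⇒ {G} rep isR ext
        }
        where
        G = RelationGraph.relationGraph isR
        rep = RelationGraph.represents isR
        Reaches-resp : ∀ {u y y′} → y ≈ y′ → Reaches a r u y → Reaches a r u y′
        Reaches-resp e (n , n∈ , p , p∈ , U , Y , step) =
          n , n∈ , p , p∈ , U , Holds-resp E.refl E.refl e Y , step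

      -- The code of a set.

      module _ (x : 𝐕) where

        private
          -- The axiom gives the least transitive set including a given set; applied to `{x}`, it
          -- gives the least one having `x` as a member.
          closure : ∃[ t ] x ∈ t × Transitive t × (∀ s → x ∈ s → Transitive s → t ⊆ s)
          closure =
            let p , x∈p , _ , p-elim = unorderedPair x x
                t , p⊆t , trans , least = transitiveClosure p
            in t , p⊆t x x∈p , trans , λ s x∈s → least s λ z z∈p → singleton x∈s (p-elim z z∈p)
            where
            singleton : ∀ {s z} → x ∈ s → z ≈ x ⊎ z ≈ x → z ∈ s
            singleton x∈s (inj₁ e) = ∈-respˡ (E.sym e) x∈s
            singleton x∈s (inj₂ e) = ∈-respˡ (E.sym e) x∈s

          t : 𝐕
          t = proj₁ closure

          x∈t : x ∈ t
          x∈t = proj₁ (proj₂ closure)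

          t-transitive : Transitive t
          t-transitive = proj₁ (proj₂ (proj₂ closure))

          ∈-relation : ∃[ r ] IsRelation r t t × (∀ y z → Holds r y z ⇔ (y ∈ t × z ∈ t × y ∈ z))
          ∈-relation = relation t t [] (v1 ∈̇ v0) _ (λ _ _ _ → mk⇔ id id)

          r : 𝐕
          r = proj₁ ∈-relation

          isR : IsRelation r t t
          isR = proj₁ (proj₂ ∈-relation)

          r-elim : ∀ {y z} → Holds r y z → y ∈ z
          r-elim {y} {z} H = proj₂ (proj₂ (to (proj₂ (proj₂ ∈-relation) y z) H))

          r-intro : ∀ {y z} → z ∈ t → y ∈ z → Holds r y z
          r-intro {y} {z} z∈ y∈z =
            from (proj₂ (proj₂ ∈-relation) y z) (t-transitive z z∈ y y∈z , z∈ , y∈z)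

          wf : IsWellFoundedRelation t r
          wf s s⊆t ind = extensionality s t λ y → mk⇔ (s⊆t y)
            (foundation (v0 ∈̇ v1 ⇒̇ v0 ∈̇ v2) (t ∷ s ∷ [])
              (λ y IH y∈ → ind y y∈ λ z H → IH z (r-elim H) (proj₁ (relation-∈ isR H))) y)

          ext : IsExtensionalRelation t r
          ext y z y∈ z∈ h = extensionality y z λ w → mk⇔
            (λ w∈y → r-elim (to (h w) (r-intro y∈ w∈y)))
            (λ w∈z → r-elim (from (h w) (r-intro z∈ w∈z)))

          reaches : ∀ y → y ∈ t → Reaches t r y x
          reaches y y∈ =
            let s , S = reachable t r x in
            proj₂ (to (S y) (proj₂ (proj₂ (proj₂ closure)) s
              (from (S x) (x∈t , Reaching.Reaches-refl x∈t))
              (λ u u∈s w w∈u →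
                let u∈t , R = to (S u) u∈s
                    w∈t = t-transitive u u∈t w w∈u
                in from (S w) (w∈t , Reaching.Reaches-extend w∈t (r-intro u∈t w∈u) R))
              y y∈))

        abstract
          membershipGraph : WFExtAPG
          membershipGraph = wfExtAPG isR wf ext x∈t reaches

          isMembershipGraph : MembershipGraph x membershipGraph
          isMembershipGraph = record
            { contains = x∈t
            ; transitive = t-transitive
            ; least = proj₂ (proj₂ (proj₂ closure))
            ; membership = λ u v → mk⇔
                (λ p → r-elim (to (RelationGraph.represents isR u v) p))
                (λ u∈v → from (RelationGraph.represents isR u v) (r-intro (val-∈ v) u∈v))
            ; root = val-name x∈t
            }

      -- Equality and membership between codes.

      initial-embedding-trivial : ∀ {a b} (h : Function a b) → Transitive a →
        (∀ {u u′ v v′} → Holds (graph h) u u′ → Holds (graph h) v v′ → u ∈ v ⇔ u′ ∈ v′) →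
        (∀ {v v′ w} → Holds (graph h) v v′ → w ∈ v′ → ∃[ u ] Holds (graph h) u w) →
        ∀ {u u′} → Holds (graph h) u u′ → u ≈ u′
      initial-embedding-trivial {a} {b} h trans h-∈ initial H =
        -- Suppose `h` fixes the members of `u`. Each of them then lies in `u′`, the image of `u`.
        -- Conversely, a member of `u′` has a preimage, which lies in `u` and so is fixed.
        foundation (∀̇∈ v1 (⌜Holds⌝ v3 v1 v0 ⇒̇ v1 ≈̇ v0)) (b ∷ graph h ∷ [])
          (λ u IH u′ _ H → extensionality u u′ λ w → mk⇔
            (λ w∈u →
              let w∈a = trans u (proj₁ (holds-∈ h H)) w w∈u
                  W = ap-holds h w w∈a
              in ∈-respˡ (E.sym (IH w w∈u _ (ap-∈ h w w∈a) W)) (to (h-∈ W H) w∈u))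
            (λ w∈u′ →
              let v , V = initial H w∈u′
                  v∈u = from (h-∈ V H) w∈u′
              in ∈-respˡ (IH v v∈u w (proj₂ (holds-∈ h V)) V) v∈u))
          _ _ (proj₂ (holds-∈ h H)) H

      -- Both carriers are the least transitive set containing the same element, so each includes
      -- the other and the inclusion is an isomorphism.
      MembershipGraph-cong : ∀ {x y G H} → MembershipGraph x G → MembershipGraph y H →
                             x ≈ y → G ≅ₐ H
      MembershipGraph-cong {x} {y} {G} {H} M M′ x≈y =
        ≅-intro G.pointedGraph H.pointedGraph (include X⊆Y) (include-injective X⊆Y)
          (λ z z∈ → z , include-intro X⊆Y (Y⊆X z z∈))
          (λ u v → mk⇔
            (λ p → from (M′.membership (i ∘ u) (i ∘ v))
              (∈-respˡ (E.sym (i-val u)) (∈-respʳ (E.sym (i-val v)) (to (M.membership u v) p))))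
            (λ p → from (M.membership u v)
              (∈-respˡ (i-val u) (∈-respʳ (i-val v) (to (M′.membership (i ∘ u) (i ∘ v)) p)))))
          (Holds-resp E.refl E.refl (E.trans M.root (E.trans x≈y (E.sym M′.root)))
            (include-intro X⊆Y (val-∈ G.⋆)))
        where
        module G = WFExtAPG G
        module H = WFExtAPG H
        module M = MembershipGraph M
        module M′ = MembershipGraph M′
        X⊆Y : G.X ⊆ H.X
        X⊆Y = M.least H.X (∈-respˡ (E.sym x≈y) M′.contains) M′.transitive
        Y⊆X : H.X ⊆ G.X
        Y⊆X = M′.least G.X (∈-respˡ x≈y M.contains) M.transitive
        i : Function G.X H.X
        i = include X⊆Y
        i-val : ∀ u → val (i ∘ u) ≈ val u
        i-val u = include-elim X⊆Y (val-∘ i u)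

      -- `G` itself is the slice of `H` at the node `c` naming `x`, by inclusion of carriers. Paths
      -- in `G` to its root map to paths to `c`, which gives one half of `nodes`.
      ∈⇒ε : ∀ {x y G H} → MembershipGraph x G → MembershipGraph y H → x ∈ y → G ε H
      ∈⇒ε {x} {y} {G} {H} M M′ x∈y =
          c , from (M′.membership c H.⋆) (∈-respˡ (E.sym c≈x) (∈-respʳ (E.sym M′.root) x∈y)) ,
          G.pointedGraph ,
          record
          { incl = i
          ; incl-mono = injective⇒Mono i (include-injective X⊆Y)
          ; nodes = λ u → mk⇔
              (λ u∈i → let w , w∈ , I = to (∈ₘ⇔ H.graph i u) u∈i in
                Path-resp H.graph {i ∘ name w∈} {u} {i ∘ G.⋆} {c}
                  (∘≐-intro i (name w∈) u (val-name w∈) I)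
                  i∘⋆≐c
                  (Path-map G.graph H.graph i (λ u v → to (i-≺ u v)) (G.accessible (name w∈))))
              (λ P → from (∈ₘ⇔ H.graph i u)
                (val u , u-∈ u P , include-intro X⊆Y (u-∈ u P)))
          ; full = i-≺
          ; point = i∘⋆≐c
          } ,
          ≅-refl
        where
        module G = WFExtAPG G
        module H = WFExtAPG H
        module M = MembershipGraph M
        module M′ = MembershipGraph M′
        x∈Y : x ∈ H.X
        x∈Y = M′.transitive y M′.contains x x∈y
        c : H.Node
        c = name x∈Y
        c≈x : val c ≈ x
        c≈x = val-name x∈Y
        X⊆Y : G.X ⊆ H.X
        X⊆Y = M.least H.X x∈Y M′.transitive
        i : Function G.X H.X
        i = include X⊆Y
        i-val : ∀ u → val (i ∘ u) ≈ val u
        i-val u = include-elim X⊆Y (val-∘ i u)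
        i-≺ : ∀ u v → u G.≺ v ⇔ (i ∘ u) H.≺ (i ∘ v)
        i-≺ u v = mk⇔
          (λ p → from (M′.membership (i ∘ u) (i ∘ v))
            (∈-respˡ (E.sym (i-val u)) (∈-respʳ (E.sym (i-val v)) (to (M.membership u v) p))))
          (λ p → from (M.membership u v)
            (∈-respˡ (i-val u) (∈-respʳ (i-val v) (to (M′.membership (i ∘ u) (i ∘ v)) p))))
        i∘⋆≐c : i ∘ G.⋆ ≐ c
        i∘⋆≐c = val-injective (i ∘ G.⋆) c (E.trans (i-val G.⋆) (E.trans M.root (E.sym c≈x)))
        -- The other half: the carrier of `G` is transitive and contains `x`, so a path leading to
        -- `c` never leaves it.
        u-∈ : ∀ u → H.Path u c → val u ∈ G.X
        u-∈ u P =
          let r , isR , rep = edges H.graph in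
          RepresentedPaths.Path-closed H.graph isR rep u c P (∈-respˡ (E.sym c≈x) M.contains)
            λ v w R w∈X →
              let v∈ , w∈ = relation-∈ isR R
                  p = Represented.Holds⇒≺ {H.graph} rep (name v∈) (name w∈)
                        (val-name v∈) (val-name w∈) R
              in M.transitive w w∈X v (∈-respˡ (val-name v∈) (∈-respʳ (val-name w∈)
                   (to (M′.membership (name v∈) (name w∈)) p)))

      -- The isomorphism followed by the inclusion of the slice is an initial embedding, hence moves
      -- nothing. It sends the root of `G`, with value `x`, to `c`, whose value is a member of `y`.
      ε⇒∈ : ∀ {x y G H} → MembershipGraph x G → MembershipGraph y H → G ε H → x ∈ y
      ε⇒∈ {x} {y} {G} {H} M M′ (c , c≺⋆ , S , slice , G≅S) =
          ∈-respˡ (E.trans (E.sym ⋆≈c) M.root) (∈-respʳ M′.root (to (M′.membership c H.⋆) c≺⋆))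
        where
        module G = WFExtAPG G
        module H = WFExtAPG H
        module S = PointedGraph S
        module M = MembershipGraph M
        module M′ = MembershipGraph M′
        open IsSlice slice
        open _≅_ G≅S
        h : Function G.X H.X
        h = incl ∘ fwd
        h-node : ∀ {v v′} (V : Function 𝟙 G.X) → val V ≈ v → Holds (graph h) v v′ →
                 val (incl ∘ (fwd ∘ V)) ≈ v′
        h-node V e H = holds-unique h
          (∘-intro incl fwd (val-∘ fwd V) (val-∘ incl (fwd ∘ V)))
          (Holds-resp E.refl (E.sym e) E.refl H)
        h-≺ : ∀ u v → u G.≺ v ⇔ (incl ∘ (fwd ∘ u)) H.≺ (incl ∘ (fwd ∘ v))
        h-≺ u v = mk⇔
          (λ p → to (full (fwd ∘ u) (fwd ∘ v)) (to (fwd-≺ u v) p))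
          (λ p → from (fwd-≺ u v) (from (full (fwd ∘ u) (fwd ∘ v)) p))
        h-∈ : ∀ {u u′ v v′} → Holds (graph h) u u′ → Holds (graph h) v v′ → u ∈ v ⇔ u′ ∈ v′
        h-∈ A B =
          let a∈ = proj₁ (holds-∈ h A)
              b∈ = proj₁ (holds-∈ h B)
              u = name a∈
              v = name b∈
              e = val-name a∈
              e′ = val-name b∈
              d = h-node u e A
              d′ = h-node v e′ B
          in mk⇔
            (λ u∈v → ∈-respˡ d (∈-respʳ d′ (to (M′.membership (incl ∘ (fwd ∘ u)) (incl ∘ (fwd ∘ v)))
              (to (h-≺ u v) (from (M.membership u v)
                (∈-respˡ (E.sym e) (∈-respʳ (E.sym e′) u∈v)))))))
            (λ u∈v → ∈-respˡ e (∈-respʳ e′ (to (M.membership u v)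
              (from (h-≺ u v) (from (M′.membership (incl ∘ (fwd ∘ u)) (incl ∘ (fwd ∘ v)))
                (∈-respˡ (E.sym d) (∈-respʳ (E.sym d′) u∈v)))))))
        -- Initiality: a predecessor of a node of the slice still has a path to `c`, so it lies in
        -- the slice and comes from `G`.
        covered : (W : H.Node) (V : G.Node) → W H.≺ (incl ∘ (fwd ∘ V)) →
                  ∀ {w} → val W ≈ w → ∃[ u ] Holds (graph h) u w
        covered W V W≺ e =
          let P = Path-extend H.graph W (incl ∘ (fwd ∘ V)) c W≺
                    (to (nodes (incl ∘ (fwd ∘ V))) (fwd ∘ V , E.refl))
              t , t∈ , I = to (∈ₘ⇔ H.graph incl W) (from (nodes W) P)
              u , F = rightInverse⇒surjective fwd bwd fwd∘bwd t t∈
          in u , ∘-intro incl fwd F (Holds-resp E.refl E.refl e I)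
        below : (W : H.Node) (V : G.Node) → ∀ {v v′ w} → val W ≈ w → val V ≈ v →
                Holds (graph h) v v′ → w ∈ v′ → W H.≺ (incl ∘ (fwd ∘ V))
        below W V e e′ A w∈v′ = from (M′.membership W (incl ∘ (fwd ∘ V)))
          (∈-respˡ (E.sym e) (∈-respʳ (E.sym (h-node V e′ A)) w∈v′))
        initial : ∀ {v v′ w} → Holds (graph h) v v′ → w ∈ v′ → ∃[ u ] Holds (graph h) u w
        initial {v} {v′} {w} A w∈v′ =
          let a∈ , b∈ = holds-∈ h A
              w∈ = M′.transitive v′ b∈ w w∈v′
          in covered (name w∈) (name a∈)
               (below (name w∈) (name a∈) (val-name w∈) (val-name a∈) A w∈v′) (val-name w∈)
        ⋆≈c : val G.⋆ ≈ val c
        ⋆≈c = initial-embedding-trivial h M.transitive h-∈ initial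
          (∘-intro incl fwd (∘≐-elim fwd G.⋆ S.⋆ fwd-⋆) (∘≐-elim incl S.⋆ c point))

      -- From surjectivity to Mostowski's principle.

      ∈-irreflexive : ∀ x → x ∈ x → ⊥ {ℓ}
      ∈-irreflexive = foundation (v0 ∈̇ v0 ⇒̇ ⊥̇) [] (λ y IH y∈y → IH y y∈y y∈y)

      -- The subset of elements not related to themselves satisfies the induction condition, because
      -- an element related to itself is among its own predecessors.
      wellFounded⇒irreflexive : ∀ {a r} → IsRelation r a a → IsWellFoundedRelation a r →
                                ∀ {x} → Holds r x x → ⊥ {ℓ}
      wellFounded⇒irreflexive {a} {r} isR wf {x} H =
        let s , S = separation (⌜Holds⌝ v1 v0 v0 ⇒̇ ⊥̇) (r ∷ []) a
            s≈a = wf s (λ y y∈ → proj₁ (to (S y) y∈)) λ y y∈ h →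
              from (S y) (y∈ , λ H → proj₂ (to (S y) (h y H)) H)
        in proj₂ (to (S x) (∈-respʳ (E.sym s≈a) (proj₁ (relation-∈ isR H)))) H

      -- A well-founded extensional relation on a becomes an accessible pointed graph on
      -- a ∪ {a} by placing all elements of a below the new root a; foundation gives a ∉ a.
      module Cone {a r : 𝐕} (isR : IsRelation r a a) (wf : IsWellFoundedRelation a r)
        (ext : IsExtensionalRelation a r) where

        a⁺ : 𝐕
        a⁺ = proj₁ (successor a)

        a⊆a⁺ : a ⊆ a⁺
        a⊆a⁺ = proj₁ (proj₂ (successor a))

        a∈a⁺ : a ∈ a⁺
        a∈a⁺ = proj₁ (proj₂ (proj₂ (successor a)))

        a⁺-elim : ∀ x → x ∈ a⁺ → x ∈ a ⊎ x ≈ a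
        a⁺-elim = proj₂ (proj₂ (proj₂ (successor a)))

        private
          r⁺-relation : ∃[ s ] IsRelation s a⁺ a⁺ × (∀ x y → Holds s x y ⇔
            (x ∈ a⁺ × y ∈ a⁺ × (Holds r x y ⊎ (x ∈ a × y ≈ a))))
          r⁺-relation = relation a⁺ a⁺ (r ∷ a ∷ [])
            (⌜Holds⌝ v5 v1 v0 ∨̇ (v1 ∈̇ v6 ∧̇ v0 ≈̇ v6)) _ (λ _ _ _ → mk⇔ id id)

        r⁺ : 𝐕
        r⁺ = proj₁ r⁺-relation

        isR⁺ : IsRelation r⁺ a⁺ a⁺
        isR⁺ = proj₁ (proj₂ r⁺-relation)

        ⇒r⁺ : ∀ {x y} → Holds r x y → Holds r⁺ x y
        ⇒r⁺ {x} {y} H =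
          let x∈ , y∈ = relation-∈ isR H
          in from (proj₂ (proj₂ r⁺-relation) x y) (a⊆a⁺ x x∈ , a⊆a⁺ y y∈ , inj₁ H)

        r⁺-root : ∀ {x} → x ∈ a → Holds r⁺ x a
        r⁺-root {x} x∈ =
          from (proj₂ (proj₂ r⁺-relation) x a) (a⊆a⁺ x x∈ , a∈a⁺ , inj₂ (x∈ , E.refl))

        source-∈ : ∀ {x y} → Holds r⁺ x y → x ∈ a
        source-∈ {x} {y} H = case (proj₂ (proj₂ (to (proj₂ (proj₂ r⁺-relation) x y) H)))
          where
          case : Holds r x y ⊎ (x ∈ a × y ≈ a) → x ∈ a
          case (inj₁ R) = proj₁ (relation-∈ isR R)
          case (inj₂ (x∈ , _)) = x∈

        r⁺⇒ : ∀ {x y} → y ∈ a → Holds r⁺ x y → Holds r x y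
        r⁺⇒ {x} {y} y∈ H = case (proj₂ (proj₂ (to (proj₂ (proj₂ r⁺-relation) x y) H)))
          where
          case : Holds r x y ⊎ (x ∈ a × y ≈ a) → Holds r x y
          case (inj₁ R) = R
          case (inj₂ (_ , e)) = Polymorphic.⊥-elim (∈-irreflexive a (∈-respˡ e y∈))

        wf⁺ : IsWellFoundedRelation a⁺ r⁺
        wf⁺ s s⊆a⁺ ind = extensionality s a⁺ λ x → mk⇔ (s⊆a⁺ x) (λ x∈ → everywhere (a⁺-elim x x∈))
          where
          part : ∃[ t ] (∀ x → x ∈ t ⇔ (x ∈ a × x ∈ s))
          part = separation (v0 ∈̇ v1) (s ∷ []) a
          T = proj₂ part
          part≈a : proj₁ part ≈ a
          part≈a = wf (proj₁ part) (λ x x∈ → proj₁ (to (T x) x∈)) λ x x∈ h →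
            from (T x) (x∈ , ind x (a⊆a⁺ x x∈) λ y H → proj₂ (to (T y) (h y (r⁺⇒ x∈ H))))
          a⊆s : a ⊆ s
          a⊆s x x∈ = proj₂ (to (T x) (∈-respʳ (E.sym part≈a) x∈))
          everywhere : ∀ {x} → x ∈ a ⊎ x ≈ a → x ∈ s
          everywhere (inj₁ x∈) = a⊆s _ x∈
          everywhere (inj₂ e) =
            ∈-respˡ (E.sym e) (ind a a∈a⁺ λ y H → a⊆s y (source-∈ H))

        ext⁺ : IsExtensionalRelation a⁺ r⁺
        ext⁺ x y x∈ y∈ h = case (a⁺-elim x x∈) (a⁺-elim y y∈) h
          where
          -- Everything in `a`, in particular `x`, is a predecessor of the root. Were all those
          -- predecessors of `x` as well, `x` would precede itself.
          not-root : ∀ {x y} {A : Set ℓ} → x ∈ a → y ≈ a →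
                     (∀ z → Holds r⁺ z y → Holds r⁺ z x) → A
          not-root x∈ e h = Polymorphic.⊥-elim (wellFounded⇒irreflexive isR wf
            (r⁺⇒ x∈ (h _ (Holds-resp E.refl E.refl (E.sym e) (r⁺-root x∈)))))
          case : ∀ {x y} → x ∈ a ⊎ x ≈ a → y ∈ a ⊎ y ≈ a →
                 (∀ z → Holds r⁺ z x ⇔ Holds r⁺ z y) → x ≈ y
          case (inj₁ x∈) (inj₁ y∈) h = ext _ _ x∈ y∈ λ z → mk⇔
            (λ H → r⁺⇒ y∈ (to (h z) (⇒r⁺ H))) (λ H → r⁺⇒ x∈ (from (h z) (⇒r⁺ H)))
          case (inj₁ x∈) (inj₂ e) h = not-root x∈ e (λ z → from (h z))
          case (inj₂ e) (inj₁ y∈) h = not-root y∈ e (λ z → to (h z))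
          case (inj₂ e) (inj₂ e′) h = E.trans e (E.sym e′)

        reaches⁺ : ∀ x → x ∈ a⁺ → Reaches a⁺ r⁺ x a
        reaches⁺ x x∈ = case x∈ (a⁺-elim x x∈)
          where
          case : ∀ {x} → x ∈ a⁺ → x ∈ a ⊎ x ≈ a → Reaches a⁺ r⁺ x a
          case x∈⁺ (inj₁ x∈) =
            Reaching.Reaches-extend x∈⁺ (r⁺-root x∈) (Reaching.Reaches-refl a∈a⁺)
          case x∈⁺ (inj₂ e) =
            let n , n∈ , p , p∈ , U , rest = Reaching.Reaches-refl a∈a⁺
            in n , n∈ , p , p∈ , Holds-resp E.refl E.refl (E.sym e) U , rest

        cone : WFExtAPG
        cone = wfExtAPG isR⁺ wf⁺ ext⁺ a∈a⁺ reaches⁺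

        cone-represents : Represents (WFExtAPG.graph cone) r⁺
        cone-represents = RelationGraph.represents isR⁺

        cone-root : val (WFExtAPG.⋆ cone) ≈ a
        cone-root = val-name a∈a⁺

        -- The isomorphism carries `r⁺` to membership and the root `a` to `x`. The members of `x`
        -- are thus the images of the elements of `a`, so `x` itself is the required transitive set
        -- and the bijection is the restriction to `a`.
        collapse : ∀ {x H} → MembershipGraph x H → H ≅ₐ cone →
          ∃[ t ] Transitive t × (∃[ f ] IsBijection f a t ×
            (∀ p q u v → Holds f p u → Holds f q v → Holds r p q ⇔ u ∈ v))
        collapse {x} {H} M H≅cone =
            x , x-transitive , graph (function f) , (isFunction (function f) , f-injective , f-onto) ,
            λ p q u v P Q → mk⇔
              (λ R → to (h-∈ (f-elim P) (f-elim Q)) (⇒r⁺ R))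
              (λ u∈v → r⁺⇒ (proj₁ (holds-∈ (function f) Q)) (from (h-∈ (f-elim P) (f-elim Q)) u∈v))
          where
          module G = WFExtAPG cone
          module H = WFExtAPG H
          module M = MembershipGraph M
          open _≅_ (≅-sym H≅cone) renaming (fwd to h; bwd to h⁻¹)
          h-∈ : ∀ {p q u v} → Holds (graph h) p u → Holds (graph h) q v → Holds r⁺ p q ⇔ u ∈ v
          h-∈ P Q =
            let p∈ = proj₁ (holds-∈ h P)
                q∈ = proj₁ (holds-∈ h Q)
                p = name p∈
                q = name q∈
                e = val-∘-≈ h p P (val-name p∈)
                e′ = val-∘-≈ h q Q (val-name q∈)
            in mk⇔
              (λ R → ∈-respˡ e (∈-respʳ e′ (to (M.membership (h ∘ p) (h ∘ q)) (to (fwd-≺ p q)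
                (Represented.Holds⇒≺ {G.graph} cone-represents p q (val-name p∈) (val-name q∈) R)))))
              (λ u∈v → Represented.≺⇒Holds {G.graph} cone-represents p q (val-name p∈) (val-name q∈)
                (from (fwd-≺ p q) (from (M.membership (h ∘ p) (h ∘ q))
                  (∈-respˡ (E.sym e) (∈-respʳ (E.sym e′) u∈v)))))
          h-root : Holds (graph h) a x
          h-root = Holds-resp E.refl cone-root M.root (∘≐-elim h G.⋆ H.⋆ fwd-⋆)
          h-onto : Surjective h
          h-onto = rightInverse⇒surjective h h⁻¹ fwd∘bwd
          member : ∀ {u} → u ∈ x → ∃[ p ] p ∈ a × Holds (graph h) p u
          member {u} u∈x =
            let p , P = h-onto u (M.transitive x M.contains u u∈x)
            in p , source-∈ (from (h-∈ P h-root) u∈x) , P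
          -- A member `u` of `v` has a preimage that is the source of an edge. Only elements of `a`
          -- are sources, and their images are the members of `x`.
          x-transitive : Transitive x
          x-transitive v v∈x u u∈v =
            let q , _ , Q = member v∈x
                p , P = h-onto u (M.transitive v (proj₂ (holds-∈ h Q)) u u∈v)
            in to (h-∈ P h-root) (r⁺-root (source-∈ (from (h-∈ P Q) u∈v)))
          f : Definable a x (Holds (graph h))
          f = define a x (graph h ∷ []) (⌜Holds⌝ v5 v1 v0) _
            (λ _ _ _ → mk⇔ id id)
            (λ p p∈ → let P = ap-holds h p (a⊆a⁺ p p∈) in _ , to (h-∈ P h-root) (r⁺-root p∈) , P)
            (λ _ _ _ _ _ _ → holds-unique h)
          f-elim : ∀ {p u} → Holds (graph (function f)) p u → Holds (graph h) p u
          f-elim P = proj₂ (proj₂ (to (spec f _ _) P))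
          f-injective : Injective (function f)
          f-injective p p′ u P P′ =
            leftInverse⇒injective h h⁻¹ bwd∘fwd p p′ u (f-elim P) (f-elim P′)
          f-onto : Surjective (function f)
          f-onto u u∈x = let p , p∈ , P = member u∈x in p , from (spec f p u) (p∈ , u∈x , P)

      -- From Mostowski's principle to surjectivity.

      Mostowski⇒collapse : Mostowski → ∀ G → ∃[ x ] (∀ {H} → MembershipGraph x H → H ≅ₐ G)
      Mostowski⇒collapse mostowski G =
          x , λ {H} M → ≅-sym (≅-to M)
        where
        module G = WFExtAPG G
        r = proj₁ (edges G.graph)
        isR = proj₁ (proj₂ (edges G.graph))
        rep = proj₂ (proj₂ (edges G.graph))
        M₀ = mostowski G.X r isR
          (Represented.wellFounded⇐ {G.graph} rep isR (λ {S} → G.wellFounded {S}))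
          (Represented.extensional⇐ {G.graph} rep G.extensional)
        t = proj₁ M₀
        t-transitive : Transitive t
        t-transitive = proj₁ (proj₂ M₀)
        f : Function G.X t
        f = mkFunction (proj₁ (proj₂ (proj₂ M₀))) (proj₁ (proj₁ (proj₂ (proj₂ (proj₂ M₀)))))
        f-injective : Injective f
        f-injective = proj₁ (proj₂ (proj₁ (proj₂ (proj₂ (proj₂ M₀)))))
        f-onto : Surjective f
        f-onto = proj₂ (proj₂ (proj₁ (proj₂ (proj₂ (proj₂ M₀)))))
        f-∈ : ∀ {p q u v} → Holds (graph f) p u → Holds (graph f) q v → Holds r p q ⇔ u ∈ v
        f-∈ P Q = proj₂ (proj₂ (proj₂ (proj₂ M₀))) _ _ _ _ P Q
        -- The set whose code is `G` is the collapse of its root.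
        x : 𝐕
        x = ap f (val G.⋆) (val-∈ G.⋆)
        f-root : Holds (graph f) (val G.⋆) x
        f-root = ap-holds f (val G.⋆) (val-∈ G.⋆)
        ≅-to : ∀ {H} → MembershipGraph x H → G ≅ₐ H
        ≅-to {H} M = ≅-intro G.pointedGraph H.pointedGraph h f-injective
            (λ y y∈ → f-onto y (X⊆t y y∈))
            (λ u v → mk⇔
              (λ p → from (M.membership (h ∘ u) (h ∘ v)) (to (f-∈ (val-∘ h u) (val-∘ h v)) (to (rep u v) p)))
              (λ p → from (rep u v) (from (f-∈ (val-∘ h u) (val-∘ h v)) (to (M.membership (h ∘ u) (h ∘ v)) p))))
            (Holds-resp E.refl E.refl (E.sym M.root) f-root)
          where
          module H = WFExtAPG H
          module M = MembershipGraph M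
          X⊆t : H.X ⊆ t
          X⊆t = M.least t (ap-∈ f (val G.⋆) (val-∈ G.⋆)) t-transitive
          hit : ∃[ s ] (∀ p → p ∈ s ⇔ (p ∈ G.X × (∃[ y ] y ∈ H.X × Holds (graph f) p y)))
          hit = separation (∃̇∈ v1 (⌜Holds⌝ v3 v1 v0)) (H.X ∷ graph f ∷ []) G.X
          S = proj₂ hit
          -- The nodes collapsing into the closure of `{x}` include the root and are closed under
          -- predecessors, since that closure is transitive. By accessibility they are all nodes.
          lands : ∀ p → p ∈ G.X → ∃[ y ] y ∈ H.X × Holds (graph f) p y
          lands p p∈ = proj₂ (to (S p) (∈-respˡ (val-name p∈)
            (RepresentedPaths.Path-closed G.graph isR rep (name p∈) G.⋆ (G.accessible (name p∈))
              (from (S (val G.⋆)) (val-∈ G.⋆ , x , M.contains , f-root))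
              λ q w R w∈s →
                let w∈ , y , y∈ , W = to (S w) w∈s
                    q∈ = proj₁ (relation-∈ isR R)
                    Q = ap-holds f q q∈
                in from (S q) (q∈ , ap f q q∈ ,
                     M.transitive y y∈ (ap f q q∈) (to (f-∈ Q W) R) , Q))))
          -- The graph of `f` is kept and only its codomain shrinks from `t`, so `f-injective` and
          -- `f-onto` apply to `h` as they are.
          h : Function G.X H.X
          h = mkFunction (graph f)
            ((λ p p∈ → let u , u∈ , y , _ , P = proj₁ (isFunction f) p p∈
                           y′ , y′∈ , F = lands u u∈
                       in u , u∈ , y , ∈-respˡ (holds-unique f F (p , p∈ , P)) y′∈ , P) ,
             proj₂ (isFunction f))

      -- The canonical embedding and when it is an isomorphism.

      module 𝕍 = ∈-Structure 𝕍

      membershipGraph-∈ : ∀ {x y} → x ∈ y → membershipGraph x 𝕍.∈ membershipGraph y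
      membershipGraph-∈ {x} {y} = ∈⇒ε (isMembershipGraph x) (isMembershipGraph y)

      membershipGraph-∈⁻¹ : ∀ {x y} → membershipGraph x 𝕍.∈ membershipGraph y → x ∈ y
      membershipGraph-∈⁻¹ {x} {y} = ε⇒∈ (isMembershipGraph x) (isMembershipGraph y)

      membershipGraph-cong : ∀ {x y} → x ≈ y → membershipGraph x 𝕍.≈ membershipGraph y
      membershipGraph-cong {x} {y} = MembershipGraph-cong (isMembershipGraph x) (isMembershipGraph y)

      -- Isomorphic codes have the same members up to `ε`, and membership is reflected, so
      -- extensionality in `V` identifies the sets.
      membershipGraph-injective : ∀ {x y} → membershipGraph x 𝕍.≈ membershipGraph y → x ≈ y
      membershipGraph-injective {x} {y} e = extensionality x y λ z → mk⇔
        (λ z∈x → membershipGraph-∈⁻¹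
          (ε-respʳ {membershipGraph z} {membershipGraph x} {membershipGraph y} e (membershipGraph-∈ z∈x)))
        (λ z∈y → membershipGraph-∈⁻¹
          (ε-respʳ {membershipGraph z} {membershipGraph y} {membershipGraph x} (≅-sym e) (membershipGraph-∈ z∈y)))

      membershipGraph-monomorphism : IsOrderMonomorphism _≈_ 𝕍._≈_ _∈_ 𝕍._∈_ membershipGraph
      membershipGraph-monomorphism = record
        { isOrderHomomorphism = record { cong = membershipGraph-cong ; mono = membershipGraph-∈ }
        ; injective = membershipGraph-injective
        ; cancel = membershipGraph-∈⁻¹
        }

      isomorphism⇔Mostowski :
        IsOrderIsomorphism _≈_ 𝕍._≈_ _∈_ 𝕍._∈_ membershipGraph ⇔ Mostowski
      isomorphism⇔Mostowski = mk⇔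
        (λ iso a r isR wf ext →
          let x , h = IsOrderIsomorphism.surjective iso (Cone.cone isR wf ext)
          in Cone.collapse isR wf ext (isMembershipGraph x) (h E.refl))
        (λ mostowski → record
          { isOrderMonomorphism = membershipGraph-monomorphism
          ; surjective = λ G →
              let x , h = Mostowski⇒collapse mostowski G
              in x , λ {z} z≈x → ≅-trans (membershipGraph-cong z≈x) (h (isMembershipGraph x))
          })

      canonicalEmbedding : CanonicalEmbedding
      canonicalEmbedding = record
        { embed        = membershipGraph
        ; monomorphism = membershipGraph-monomorphism
        ; isMembership = isMembershipGraph
        ; isomorphism  = isomorphism⇔Mostowski
        }

-- Specialisation to the category of sets of `V`.

module _ {ℓ} (V : ∈-Structure ℓ) (core : Axioms.CoreAxioms V)
  (infinity : Axioms.Infinity V) (exponentials : Axioms.Exponentials V)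
  (foundation : Axioms.Foundation V) (transitiveClosure : Axioms.TransitiveClosures V) where

  private
    module S = Sets V core
    module N = S.Naturals infinity exponentials

  canonicalEmbedding-𝕊et :
    Canonical.CanonicalEmbedding V S.𝕊et S.terminal N.nno id S.value
  canonicalEmbedding-𝕊et =
    Embedding.Graphical.Realisation.canonicalEmbedding V core infinity exponentials
      foundation transitiveClosure
      S._∘F_ S.∘F-intro S.∘F-elim S.idF S.idF-intro
      (Category.assoc S.𝕊et) (Category.identityˡ S.𝕊et) (Category.identityʳ S.𝕊et)
      (λ {_} {_} {_} {g} {g′} {f} {f′} → Category.∘-resp-≈ S.𝕊et {_} {_} {_} {g} {g′} {f} {f′})
      S.one S.∅∈one (λ _ → id) (Terminal.! S.terminal) (Terminal.!-unique S.terminal)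
      N.nno (λ _ → id) (λ _ → id)
      (λ H → proj₂ (proj₂ (to (spec (S.constant S.one N.∅∈ω) _ _) H)))
      (λ x∈ S → from (spec N.succession _ _) (x∈ , N.successor∈ω x∈ S , S))
      (λ H → proj₂ (proj₂ (to (spec N.succession _ _) H)))
    where open S.Definable

open import Defs

proposition9p3 :
  ∀ {ℓ} (V : ∈-Structure ℓ)
  (core : CoreAxioms V) (infinity : Infinity V) (exponentials : Exponentials V) →
  Foundation V → TransitiveClosures V →
  let open ∈-Structure V
      open Sets.Naturals V core infinity exponentials
      module 𝕍 = ∈-Structure 𝕍
  in
  Σ[ F ∈ (Carrier → 𝕍.Carrier) ]
    IsOrderMonomorphism _≈_ 𝕍._≈_ _∈_ 𝕍._∈_ F ×
    (∀ x → IsMembershipGraph x (F x)) ×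
    (IsOrderIsomorphism _≈_ 𝕍._≈_ _∈_ 𝕍._∈_ F ⇔ Mostowski V)
proposition9p3 V core infinity exponentials foundation closures =
  embed , monomorphism ,
  -- With `ob` the identity and `val` equal to `value`, the two record types have the same fields,
  -- which are copied one by one.
  (λ x → let open Canonical.MembershipGraph (isMembership x) in record
    { contains = contains ; transitive = transitive ; least = least
    ; membership = membership ; root = root }) ,
  isomorphism
  where
  open Canonical.CanonicalEmbedding
    (canonicalEmbedding-𝕊et V core infinity exponentials foundation closures)
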